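{- Let $m\geq 2$ be an integer. For a positive integer $n$ and residues $j,k$ modulo $m$, let $q_{j,k,m}(n)$ denote the number of partitions of $n$ in which no part equals $1$ and in which the number of parts congruent to $j$ modulo $m$ is strictly greater than the number of parts congruent to $k$ modulo $m$. Then for all integers $n\geq 4m+3$, \[ q_{0,1,m}(n) > q_{1,0,m}(n). \]
   Context: A partition of $n$ is a non-increasing sequence of positive integers summing to $n$; its entries are its parts. Partitions with no part equal to $1$ are called non-unitary partitions. -}

module Defs where

open import Data.Nat using (ℕ; zero; suc; _+_; _∸_; _<_; _≤_; _%_; _≡ᵇ_; _<ᵇ_; NonZero)
open import Data.Nat.Properties using (_≤?_; _<?_; _≟_)
open import Data.Bool using (Bool; true; false; not; _∧_; if_then_else_)
import Data.Bool
open import Data.List using (List; []; _∷_; _++_; map; length; filter; applyUpTo; concatMap)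
open import Relation.Nullary.Decidable using (⌊_⌋)

-- A partition is represented as a list of parts in non-increasing order.
-- partsBounded fuel n k : all partitions of n with every part in {1,...,k},
-- listed as non-increasing lists of positive integers summing to n.
-- fuel ≥ n guarantees termination (each step removes a positive part).
partsBounded : ℕ → ℕ → ℕ → List (List ℕ)
partsBounded _        zero    _ = [] ∷ []
partsBounded zero     (suc _) _ = []
partsBounded (suc f)  (suc n) k =
  concatMap (λ p → map (λ rest → p ∷ rest) (partsBounded f (suc n ∸ p) p))
            (filter (λ p → p ≤? k) (filter (λ p → p ≤? suc n) (applyUpTo suc (suc n))))

partitions : ℕ → List (List ℕ)
partitions n = partsBounded n n n

countCong : (m : ℕ) → .{{NonZero m}} → ℕ → List ℕ → ℕ
countCong m r []      = 0
countCong m r (x ∷ xs) = if (x % m) ≡ᵇ (r % m) then suc (countCong m r xs) else countCong m r xs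

nonUnitary? : List ℕ → Bool
nonUnitary? []       = true
nonUnitary? (x ∷ xs) = not (x ≡ᵇ 1) ∧ nonUnitary? xs

q : (j k m : ℕ) → .{{NonZero m}} → ℕ → ℕ
q j k m n = length (filter (λ λs → ⌊ countCong m k λs <? countCong m j λs ⌋ Data.Bool.≟ true)
                           (filter (λ λs → nonUnitary? λs Data.Bool.≟ true) (partitions n)))

{-# OPTIONS --safe #-}
module Submission where

-- Call the parts divisible by m zeros and the parts congruent to 1 modulo m ones.  A partition with
-- d more ones than zeros is turned into one with more zeros than ones, injectively.  Exchanging the
-- classes (k m + 1 becomes k m and conversely) loses d, which has to be put back recognisably.
--
-- For m ≥ 4 and d ≥ 2 this is done by adding parts 2 and 3.  For d = 1, a part 3 becomes 2 + 2;
-- if there is none, then all but at most one of the u parts 2 absorb the missing 1 and become an odd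
-- number of parts 3, unless u = 3 j.  In that case, if there are a ≥ 1 zeros, remove the smallest
-- zero (i + 1) m before the exchange and subtract i m from the others; the 1 + a i units of m set
-- free become parts m, and the missing 1 together with the 1 lost in removing the zero is a part 2.
-- The image has d ≥ 3, and 2 + 6 j can be written with twos and threes so as not to contain the
-- parts added for d ≥ 2.  There remain partitions with a single one and no zeros, which are sent to
-- unused partitions whose excess of zeros is 1 or 2.  For m = 3 the largest zero grows by 3 instead
-- of a part 3 being added.
--
-- For m = 2 the number of ones has fixed parity.  If d is even, the exchange is completed by raising
-- the largest zero by d.  If d ≥ 3 is odd, one part stays among the ones in the exchange, and the
-- largest zero is raised.  If d = 1, the smallest zero is dissolved as above, the image being chosen
-- such that its largest zero is too close to the second largest one to have been raised; the cases
-- of at most one zero are treated separately.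

open import Defs
open import Data.Bool using (Bool; true; false; if_then_else_; T; _∧_)
import Data.Bool
open import Data.Bool.Properties using (∧-zeroʳ)
open import Data.List using (List; []; _∷_; [_]; _++_; map; length; filter; replicate; applyUpTo; concatMap; drop; initLast; _∷ʳ′_)
open import Data.List.Membership.Propositional using (_∈_; find; lose)
open import Data.List.Membership.Propositional.Properties
open import Data.List.Properties using (length-++; length-map; length-replicate; filter-++; filter-all; filter-none; ++-identityʳ; map-injective; ∷-injective; ∷-injectiveˡ; ∷-injectiveʳ; ∷ʳ-injective)
open import Data.List.Relation.Binary.Disjoint.Propositional using (Disjoint)
open import Data.List.Relation.Binary.Permutation.Propositional as Perm using (_↭_; ↭-refl; ↭-reflexive; ↭-sym; ↭-trans; prep; swap)
open import Data.List.Relation.Binary.Permutation.Propositional.Properties using (filter-↭; ∈-resp-↭; All-resp-↭; drop-∷; shift; ↭-length; ++⁺ˡ)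
open import Data.List.Relation.Unary.All as All using (All; []; _∷_)
import Data.List.Relation.Unary.All.Properties as All
open import Data.List.Relation.Unary.AllPairs as AllPairs using (AllPairs; []; _∷_)
import Data.List.Relation.Unary.AllPairs.Properties as AllPairs
open import Data.List.Relation.Unary.Any using (here; there)
open import Data.List.Relation.Unary.Unique.Propositional using (Unique)
import Data.List.Relation.Unary.Unique.Propositional.Properties as Unique
open import Data.List.Relation.Unary.Sorted.TotalOrder.Properties using (Sorted⇒AllPairs)
open import Data.Nat using (ℕ; zero; suc; _+_; _*_; _∸_; _≤_; _<_; _≥_; z≤n; s≤s; _%_; _/_; _≡ᵇ_; _<ᵇ_; NonZero; ⌊_/2⌋)
open import Data.Nat.DivMod using (m*n/n≡m; /-monoˡ-≤; [m+kn]%n≡m%n; m*n%n≡0; m<n⇒m%n≡m; m≡m%n+[m/n]*n; m%n<n)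
open import Data.Nat.ListAction using (sum)
open import Data.Nat.ListAction.Properties using (sum-++; sum-↭)
open import Data.Nat.Properties
open import Data.Nat.Tactic.RingSolver using (solve-∀)
open import Data.Product using (∃; ∃₂; _×_; _,_; proj₁; proj₂)
open import Data.Sum using (_⊎_; inj₁; inj₂)
open import Function using (_∘_)
open import Relation.Binary.Bundles using (DecTotalOrder)
import Relation.Binary.Construct.Flip.EqAndOrd as Flip
open import Relation.Binary.PropositionalEquality using (_≡_; _≢_; refl; sym; trans; cong; cong₂; subst; subst₂; module ≡-Reasoning)
open import Relation.Nullary using (¬_; yes; no; contradiction)
open import Relation.Nullary.Decidable using (⌊_⌋; ¬?; from-no)
open import Relation.Unary using (Decidable)

-- Strict counting by an injective relation

module _ {A B : Set} (R : A → B → Set) (R-injective : ∀ {x x′ y} → R x y → R x′ y → x ≡ x′) where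

  -- Induction on `xs`: the image of the head is cut out of `ys`. The images of the other elements
  -- survive the cut because `R` is injective, and `w` survives because it is missed. A relation is
  -- used instead of a function since partitions and their encodings agree only up to permutation.
  length-<-by-injection : ∀ (xs : List A) (ys : List B) → Unique xs →
    (∀ {x} → x ∈ xs → ∃ λ y → y ∈ ys × R x y) →
    ∀ {w} → w ∈ ys → (∀ {x} → x ∈ xs → ¬ R x w) → length xs < length ys
  length-<-by-injection [] (y ∷ ys) _ _ _ _ = s≤s z≤n
  length-<-by-injection (x ∷ xs) ys (x∉xs ∷ xs!) image {w} w∈ys missed
    with image (here refl)
  ... | y , y∈ys , Rxy with ∈-∃++ y∈ys
  ... | as , bs , refl = ≤-trans (s≤s rest) (≤-reflexive (sym length-split))
    where
    length-split : length (as ++ [ y ] ++ bs) ≡ suc (length (as ++ bs))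
    length-split = begin
      length (as ++ y ∷ bs)           ≡⟨ length-++ as ⟩
      length as + suc (length bs)     ≡⟨ +-suc _ _ ⟩
      suc (length as + length bs)     ≡⟨ cong suc (sym (length-++ as)) ⟩
      suc (length (as ++ bs))         ∎
      where open ≡-Reasoning
    avoid : ∀ {z} → z ∈ as ++ [ y ] ++ bs → z ≢ y → z ∈ as ++ bs
    avoid z∈ z≢y with ∈-++⁻ as z∈
    ... | inj₁ z∈as = ∈-++⁺ˡ z∈as
    ... | inj₂ (here z≡y) = contradiction z≡y z≢y
    ... | inj₂ (there z∈bs) = ∈-++⁺ʳ as z∈bs
    rest : length xs < length (as ++ bs)
    rest = length-<-by-injection xs (as ++ bs) xs!
      (λ {x′} x′∈ → let (y′ , y′∈ , Rx′y′) = image (there x′∈) in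
        y′ , avoid y′∈ (λ y′≡y → All.lookup x∉xs x′∈ (R-injective Rxy (subst (R x′) y′≡y Rx′y′))) , Rx′y′)
      (avoid w∈ys λ { refl → missed (here refl) Rxy })
      (λ x′∈ → missed (there x′∈))

-- Correctness of the enumeration of partitions

Descending : List ℕ → Set
Descending = AllPairs _≥_

IsPartition : ℕ → List ℕ → Set
IsPartition n ps = Descending ps × All (1 ≤_) ps × sum ps ≡ n

-- The list of first parts that occurs inside `partsBounded`, named so that membership and
-- uniqueness can be stated for it.
candidates : ℕ → ℕ → List ℕ
candidates n k = filter (λ p → p ≤? k) (filter (λ p → p ≤? suc n) (applyUpTo suc (suc n)))

∈-candidates⁻ : ∀ {n k p} → p ∈ candidates n k → 1 ≤ p × p ≤ suc n × p ≤ k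
∈-candidates⁻ {n} {k} p∈
  with p∈′ , p≤k ← ∈-filter⁻ (λ p → p ≤? k) {xs = filter (λ p → p ≤? suc n) (applyUpTo suc (suc n))} p∈
  with p∈″ , p≤n ← ∈-filter⁻ (λ p → p ≤? suc n) {xs = applyUpTo suc (suc n)} p∈′
  with i , _ , refl ← ∈-applyUpTo⁻ suc p∈″ = s≤s z≤n , p≤n , p≤k

∈-candidates⁺ : ∀ {n k p} → 1 ≤ p → p ≤ suc n → p ≤ k → p ∈ candidates n k
∈-candidates⁺ {n} {k} {suc p} _ p≤n p≤k =
  ∈-filter⁺ (λ p → p ≤? k) (∈-filter⁺ (λ p → p ≤? suc n) (∈-applyUpTo⁺ suc p≤n) p≤n) p≤k

∈-partsBounded⁻ : ∀ f n k {ps} → ps ∈ partsBounded f n k → All (_≤ k) ps × IsPartition n ps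
∈-partsBounded⁻ zero zero k (here refl) = [] , [] , [] , refl
∈-partsBounded⁻ (suc f) zero k (here refl) = [] , [] , [] , refl
∈-partsBounded⁻ (suc f) (suc n) k ps∈
  with p , p∈ , ps∈′ ← find (∈-concatMap⁻ (λ p → map (p ∷_) (partsBounded f (suc n ∸ p) p)) {xs = candidates n k} ps∈)
  with 1≤p , p≤n , p≤k ← ∈-candidates⁻ {n} {k} p∈
  with rest , rest∈ , refl ← ∈-map⁻ (p ∷_) ps∈′
  with rest≤p , desc , pos , total ← ∈-partsBounded⁻ f (suc n ∸ p) p rest∈
  = p≤k ∷ All.map (λ q≤p → ≤-trans q≤p p≤k) rest≤p , rest≤p ∷ desc , 1≤p ∷ pos
  , (begin p + sum rest     ≡⟨ cong (p +_) total ⟩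
           p + (suc n ∸ p)  ≡⟨ m+[n∸m]≡n p≤n ⟩
           suc n            ∎)
  where open ≡-Reasoning

∈-partsBounded⁺ : ∀ f n k {ps} → n ≤ f → All (_≤ k) ps → IsPartition n ps → ps ∈ partsBounded f n k
∈-partsBounded⁺ zero zero k {[]} _ _ _ = here refl
∈-partsBounded⁺ (suc f) zero k {[]} _ _ _ = here refl
∈-partsBounded⁺ f zero k {suc p ∷ ps} _ _ (_ , _ , ())
∈-partsBounded⁺ f zero k {zero ∷ ps} _ _ (_ , () ∷ _ , _)
∈-partsBounded⁺ f (suc n) k {[]} _ _ (_ , _ , ())
∈-partsBounded⁺ (suc f) (suc n) k {zero ∷ ps} _ _ (_ , () ∷ _ , _)
∈-partsBounded⁺ (suc f) (suc n) k {suc p ∷ ps} (s≤s n≤f) (p≤k ∷ _) (ps≤p ∷ desc , _ ∷ pos , total) =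
  ∈-concatMap⁺ (λ p → map (p ∷_) (partsBounded f (suc n ∸ p) p))
    (lose (∈-candidates⁺ (s≤s z≤n) p≤n p≤k)
      (∈-map⁺ (suc p ∷_) (∈-partsBounded⁺ f (n ∸ p) (suc p) (≤-trans (m∸n≤m n p) n≤f) ps≤p
        (desc , pos , sum-rest))))
  where
  p≤n : suc p ≤ suc n
  p≤n = ≤-trans (m≤m+n (suc p) (sum ps)) (≤-reflexive total)
  sum-rest : sum ps ≡ n ∸ p
  sum-rest = sym (trans (cong (_∸ p) (sym (suc-injective total))) (m+n∸m≡n p (sum ps)))

candidates-unique : ∀ n k → Unique (candidates n k)
candidates-unique n k =
  Unique.filter⁺ (λ p → p ≤? k) (Unique.filter⁺ (λ p → p ≤? suc n)
    (Unique.applyUpTo⁺₁ suc (suc n) λ i<j _ si≡sj → <⇒≢ i<j (suc-injective si≡sj)))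

-- For a fixed first part, prepending it is injective; blocks with different first parts are
-- disjoint because the heads of their members differ.
partsBounded-unique : ∀ f n k → Unique (partsBounded f n k)
partsBounded-unique zero zero k = [] ∷ []
partsBounded-unique (suc f) zero k = [] ∷ []
partsBounded-unique zero (suc n) k = []
partsBounded-unique (suc f) (suc n) k =
  Unique.concat⁺
    (All.map⁺ (All.universal (λ p → Unique.map⁺ ∷-injectiveʳ (partsBounded-unique f (suc n ∸ p) p)) (candidates n k)))
    (AllPairs.map⁺ (AllPairs.map disjoint (candidates-unique n k)))
  where
  disjoint : ∀ {p p′} → p ≢ p′ → Disjoint (map (p ∷_) (partsBounded f (suc n ∸ p) p)) (map (p′ ∷_) (partsBounded f (suc n ∸ p′) p′))
  disjoint p≢p′ (∈p , ∈p′) with ∈-map⁻ _ ∈p | ∈-map⁻ _ ∈p′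
  ... | _ , _ , refl | _ , _ , eq = p≢p′ (∷-injectiveˡ eq)

All-≤-sum : ∀ ps → All (_≤ sum ps) ps
All-≤-sum [] = []
All-≤-sum (p ∷ ps) = m≤m+n p (sum ps) ∷ All.map (λ q≤ → ≤-trans q≤ (m≤n+m (sum ps) p)) (All-≤-sum ps)

∈-partitions⁺ : ∀ {n ps} → IsPartition n ps → ps ∈ partitions n
∈-partitions⁺ {n} {ps} isP@(_ , _ , refl) = ∈-partsBounded⁺ n n n ≤-refl (All-≤-sum ps) isP

-- Membership in the lists counted by `q`

nonUnitary⁺ : ∀ {ps} → All (2 ≤_) ps → nonUnitary? ps ≡ true
nonUnitary⁺ [] = refl
nonUnitary⁺ {suc (suc p) ∷ ps} (_ ∷ big) = nonUnitary⁺ big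
nonUnitary⁺ {suc zero ∷ ps} (s≤s () ∷ big)

nonUnitary⁻ : ∀ {ps} → All (1 ≤_) ps → nonUnitary? ps ≡ true → All (2 ≤_) ps
nonUnitary⁻ [] _ = []
nonUnitary⁻ {suc (suc p) ∷ ps} (_ ∷ pos) eq = s≤s (s≤s z≤n) ∷ nonUnitary⁻ pos eq

Biased : (j k m : ℕ) → .{{NonZero m}} → ℕ → List ℕ → Set
Biased j k m n ps = Descending ps × All (2 ≤_) ps × sum ps ≡ n × countCong m k ps < countCong m j ps

module _ (j k m : ℕ) .{{_ : NonZero m}} (n : ℕ) where

  nonUnitaries : List (List ℕ)
  nonUnitaries = filter (λ ps → nonUnitary? ps Data.Bool.≟ true) (partitions n)

  biased : List (List ℕ)
  biased = filter (λ ps → ⌊ countCong m k ps <? countCong m j ps ⌋ Data.Bool.≟ true) nonUnitaries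

  biased-unique : Unique biased
  biased-unique = Unique.filter⁺ (λ ps → ⌊ countCong m k ps <? countCong m j ps ⌋ Data.Bool.≟ true) (Unique.filter⁺ (λ ps → nonUnitary? ps Data.Bool.≟ true) (partsBounded-unique n n n))

  ∈-biased⁻ : ∀ {ps} → ps ∈ biased → Biased j k m n ps
  ∈-biased⁻ {ps} ps∈
    with ps∈′ , less ← ∈-filter⁻ (λ ps → ⌊ countCong m k ps <? countCong m j ps ⌋ Data.Bool.≟ true) {xs = nonUnitaries} ps∈
    with ps∈″ , nonU ← ∈-filter⁻ (λ ps → nonUnitary? ps Data.Bool.≟ true) {xs = partitions n} ps∈′
    with _ , desc , pos , total ← ∈-partsBounded⁻ n n n ps∈″
    with countCong m k ps <? countCong m j ps | less
  ... | yes less′ | _ = desc , nonUnitary⁻ pos nonU , total , less′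

  ∈-biased⁺ : ∀ {ps} → Biased j k m n ps → ps ∈ biased
  ∈-biased⁺ {ps} (desc , big , total , less) =
    ∈-filter⁺ (λ ps → ⌊ countCong m k ps <? countCong m j ps ⌋ Data.Bool.≟ true)
      (∈-filter⁺ (λ ps → nonUnitary? ps Data.Bool.≟ true)
        (∈-partitions⁺ (desc , All.map (≤-trans (n≤1+n 1)) big , total)) (nonUnitary⁺ big))
      less-true
    where
    less-true : ⌊ countCong m k ps <? countCong m j ps ⌋ ≡ true
    less-true with countCong m k ps <? countCong m j ps
    ... | yes _ = refl
    ... | no ≮ = contradiction less ≮

-- Gap encoding of partitions, and lists up to permutation

-- A list of gaps g₁ ∷ … ∷ gₐ encodes the partition with a parts whose j-th largest part is
-- 1 + gⱼ + … + gₐ, so that arbitrary lists of naturals encode partitions, and appending a zero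
-- appends a part 1.
partsOf : List ℕ → List ℕ
partsOf [] = []
partsOf (g ∷ gs) = suc (g + sum gs) ∷ partsOf gs

-- The sum of the encoded partition, in a recursive form that turns comparisons of weights into
-- polynomial identities.
energy : List ℕ → ℕ
energy [] = 0
energy (g ∷ gs) = suc (g + sum gs) + energy gs

sum-replicate : ∀ k x → sum (replicate k x) ≡ k * x
sum-replicate zero x = refl
sum-replicate (suc k) x = cong (x +_) (sum-replicate k x)

sum-partsOf : ∀ gs → sum (partsOf gs) ≡ energy gs
sum-partsOf [] = refl
sum-partsOf (g ∷ gs) = cong (suc (g + sum gs) +_) (sum-partsOf gs)

length-partsOf : ∀ gs → length (partsOf gs) ≡ length gs
length-partsOf [] = refl
length-partsOf (g ∷ gs) = cong suc (length-partsOf gs)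

partsOf-positive : ∀ gs → All (1 ≤_) (partsOf gs)
partsOf-positive [] = []
partsOf-positive (g ∷ gs) = s≤s z≤n ∷ partsOf-positive gs

partsOf-≤ : ∀ gs → All (_≤ suc (sum gs)) (partsOf gs)
partsOf-≤ [] = []
partsOf-≤ (g ∷ gs) = ≤-refl ∷ All.map (λ p≤ → ≤-trans p≤ (s≤s (m≤n+m (sum gs) g))) (partsOf-≤ gs)

partsOf-descending : ∀ gs → Descending (partsOf gs)
partsOf-descending [] = []
partsOf-descending (g ∷ gs) =
  All.map (λ p≤ → ≤-trans p≤ (s≤s (m≤n+m (sum gs) g))) (partsOf-≤ gs) ∷ partsOf-descending gs

partsOf-injective : ∀ {gs hs} → partsOf gs ≡ partsOf hs → gs ≡ hs
partsOf-injective {[]} {[]} _ = refl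
partsOf-injective {g ∷ gs} {h ∷ hs} eq with ∷-injective eq
... | head≡ , tail≡ with partsOf-injective {gs} {hs} tail≡
... | refl = cong (_∷ gs) (+-cancelʳ-≡ (sum gs) g h (suc-injective head≡))

largest-≤ : ∀ {k} gs → 1 ≤ k → All (_≤ k) (partsOf gs) → suc (sum gs) ≤ k
largest-≤ [] 1≤k _ = 1≤k
largest-≤ (g ∷ gs) _ (p≤k ∷ _) = p≤k

-- Each head is the maximum of its list and permutations preserve the maximum, so the heads agree
-- and can be cancelled.
descending-unique : ∀ {xs ys} → Descending xs → Descending ys → xs ↭ ys → xs ≡ ys
descending-unique {[]} {[]} _ _ _ = refl
descending-unique {[]} {y ∷ ys} _ _ eq with () ← ↭-length eq
descending-unique {x ∷ xs} {[]} _ _ eq with () ← ↭-length eq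
descending-unique {x ∷ xs} {y ∷ ys} (xs≤x ∷ dxs) (ys≤y ∷ dys) eq
  with ≤-antisym (All.lookup (≤-refl ∷ ys≤y) (∈-resp-↭ eq (here refl)))
                 (All.lookup (≤-refl ∷ xs≤x) (∈-resp-↭ (↭-sym eq) (here refl)))
... | refl = cong (x ∷_) (descending-unique dxs dys (drop-∷ eq))

module _ {Q : ℕ → Set} (Q? : Decidable Q) where

  filter-split : ∀ {xs ys} → All Q xs → All (¬_ ∘ Q) ys → filter Q? (xs ++ ys) ≡ xs
  filter-split {xs} {ys} qxs ¬qys = begin
    filter Q? (xs ++ ys)           ≡⟨ filter-++ Q? xs ys ⟩
    filter Q? xs ++ filter Q? ys   ≡⟨ cong₂ _++_ (filter-all Q? qxs) (filter-none Q? ¬qys) ⟩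
    xs ++ []                       ≡⟨ ++-identityʳ xs ⟩
    xs                             ∎
    where open ≡-Reasoning

  filter-split′ : ∀ {xs ys} → All Q xs → All (¬_ ∘ Q) ys → filter (¬? ∘ Q?) (xs ++ ys) ≡ ys
  filter-split′ {xs} {ys} qxs ¬qys = begin
    filter (¬? ∘ Q?) (xs ++ ys)                  ≡⟨ filter-++ (¬? ∘ Q?) xs ys ⟩
    filter (¬? ∘ Q?) xs ++ filter (¬? ∘ Q?) ys   ≡⟨ cong₂ _++_ (filter-none (¬? ∘ Q?) (All.map (λ q ¬q → ¬q q) qxs)) (filter-all (¬? ∘ Q?) ¬qys) ⟩
    ys                                           ∎
    where open ≡-Reasoning

  -- Filtering respects permutations, and on lists separated by `Q` it returns exactly one of the
  -- two blocks.
  ↭-split : ∀ {xs xs′ ys ys′} → All Q xs → All Q xs′ → All (¬_ ∘ Q) ys → All (¬_ ∘ Q) ys′ →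
    xs ++ ys ↭ xs′ ++ ys′ → xs ↭ xs′ × ys ↭ ys′
  ↭-split qxs qxs′ ¬qys ¬qys′ eq =
    subst₂ _↭_ (filter-split qxs ¬qys) (filter-split qxs′ ¬qys′) (filter-↭ Q? eq) ,
    subst₂ _↭_ (filter-split′ qxs ¬qys) (filter-split′ qxs′ ¬qys′) (filter-↭ (¬? ∘ Q?) eq)

-- Partitions as profiles

-- α and β encode the parts k m and k m + 1 (k ≥ 1), u and v count the parts 2 and 3 as far as
-- these are in other residue classes, and Γ holds the remaining parts.
record Profile : Set where
  constructor profile
  field
    α β : List ℕ
    u v : ℕ
    Γ : List ℕ

module Profiles (m : ℕ) .{{_ : NonZero m}} (2≤m : 2 ≤ m) where

  multiples : List ℕ → List ℕ
  multiples gs = map (_* m) (partsOf gs)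

  successors : List ℕ → List ℕ
  successors gs = map (λ k → suc (k * m)) (partsOf gs)

  contents : Profile → List ℕ
  contents (profile α β u v Γ) = multiples α ++ successors β ++ replicate u 2 ++ replicate v 3 ++ Γ

  weight : Profile → ℕ
  weight (profile α β u v Γ) = energy α * m + (energy β * m + length β + (u * 2 + (v * 3 + sum Γ)))

  Neither : ℕ → Set
  Neither x = x % m ≢ 0 × x % m ≢ 1

  Other : ℕ → Set
  Other x = Neither x × 4 ≤ x

  -- For `m` = 2 the part 2 is a multiple of `m`, and for `m` = 2 and `m` = 3 the part 3 already
  -- belongs to the class of 1 or of 0. The counters `u` and `v` must vanish there, or a partition
  -- would have several profiles.
  Valid : Profile → Set
  Valid (profile α β u v Γ) = (3 ≤ m ⊎ u ≡ 0) × (4 ≤ m ⊎ v ≡ 0) × All Other Γ × Descending Γ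

  1%m≡1 : 1 % m ≡ 1
  1%m≡1 = m<n⇒m%n≡m 2≤m

  multiples-0 : ∀ gs → All (λ x → x % m ≡ 0) (multiples gs)
  multiples-0 gs = All.map⁺ (All.universal (λ k → m*n%n≡0 k m) (partsOf gs))

  successors-1 : ∀ gs → All (λ x → x % m ≡ 1) (successors gs)
  successors-1 gs = All.map⁺ (All.universal (λ k → trans ([m+kn]%n≡m%n 1 k m) 1%m≡1) (partsOf gs))

  small-neither : ∀ {x} → 2 ≤ x → x < m → Neither x
  small-neither {x} 2≤x x<m rewrite m<n⇒m%n≡m x<m =
    (λ { refl → contradiction 2≤x λ () }) , (λ { refl → contradiction 2≤x λ { (s≤s ()) } })

  replicate-neither : ∀ {x k} → 2 ≤ x → (x < m ⊎ k ≡ 0) → All Neither (replicate k x)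
  replicate-neither {k = k} 2≤x (inj₁ x<m) = All.replicate⁺ k (small-neither 2≤x x<m)
  replicate-neither 2≤x (inj₂ refl) = []

  residual-neither : ∀ P → Valid P → let open Profile P in All Neither (replicate u 2 ++ replicate v 3 ++ Γ)
  residual-neither _ (u-ok , v-ok , Γ-ok , _) =
    All.++⁺ (replicate-neither (s≤s (s≤s z≤n)) u-ok)
      (All.++⁺ (replicate-neither (s≤s (s≤s z≤n)) v-ok) (All.map proj₁ Γ-ok))

  not-0 : ∀ {zs} gs → All Neither zs → All (λ x → x % m ≢ 0) (successors gs ++ zs)
  not-0 gs ok = All.++⁺ (All.map (λ {x} ≡1 ≡0 → contradiction (trans (sym ≡1) ≡0) λ ()) (successors-1 gs)) (All.map proj₁ ok)

  not-2 : ∀ {Γ} v → All Other Γ → All (_≢ 2) (replicate v 3 ++ Γ)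
  not-2 v ok = All.++⁺ (All.replicate⁺ v λ ()) (All.map (λ (_ , 4≤x) x≡2 → <⇒≢ (<-trans ≤-refl 4≤x) (sym x≡2)) ok)

  scaled-injective : ∀ (f : ℕ → ℕ) → (∀ {i j} → f i ≡ f j → i ≡ j) → (∀ {i j} → i ≤ j → f i ≤ f j) →
    ∀ {gs hs} → map f (partsOf gs) ↭ map f (partsOf hs) → gs ≡ hs
  scaled-injective f f-inj f-mono {gs} {hs} eq =
    partsOf-injective (map-injective f-inj (descending-unique
      (AllPairs.map⁺ (AllPairs.map f-mono (partsOf-descending gs)))
      (AllPairs.map⁺ (AllPairs.map f-mono (partsOf-descending hs))) eq))

  replicate-length : ∀ {k l} {x : ℕ} → replicate k x ↭ replicate l x → k ≡ l
  replicate-length {k} {l} eq = trans (sym (length-replicate k)) (trans (↭-length eq) (length-replicate l))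

  -- The blocks are peeled off one by one, by residue 0, residue 1, value 2 and value 3; each block
  -- determines its field.
  contents-injective : ∀ {P P′} → Valid P → Valid P′ → contents P ↭ contents P′ → P ≡ P′
  contents-injective {P@(profile α β u v Γ)} {P′@(profile α′ β′ u′ v′ Γ′)} ok@(_ , _ , Γ-ok , dΓ) ok′@(_ , _ , Γ-ok′ , dΓ′) eq
    with eq-α , eq₁ ← ↭-split (λ x → x % m ≟ 0) (multiples-0 α) (multiples-0 α′)
      (not-0 β (residual-neither P ok)) (not-0 β′ (residual-neither P′ ok′)) eq
    with eq-β , eq₂ ← ↭-split (λ x → x % m ≟ 1) (successors-1 β) (successors-1 β′)
      (All.map proj₂ (residual-neither P ok)) (All.map proj₂ (residual-neither P′ ok′)) eq₁
    with eq-u , eq₃ ← ↭-split (_≟ 2) (All.replicate⁺ u refl) (All.replicate⁺ u′ refl)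
      (not-2 v Γ-ok) (not-2 v′ Γ-ok′) eq₂
    with eq-v , eq-Γ ← ↭-split (_≟ 3) (All.replicate⁺ v refl) (All.replicate⁺ v′ refl)
      (All.map (λ (_ , 4≤x) x≡3 → <⇒≢ 4≤x (sym x≡3)) Γ-ok) (All.map (λ (_ , 4≤x) x≡3 → <⇒≢ 4≤x (sym x≡3)) Γ-ok′) eq₃
    with refl ← scaled-injective (_* m) (λ {i} {j} → *-cancelʳ-≡ i j m) (*-monoˡ-≤ m) {α} {α′} eq-α
    with refl ← scaled-injective (λ k → suc (k * m)) (λ {i} {j} → *-cancelʳ-≡ i j m ∘ suc-injective) (λ k≤l → s≤s (*-monoˡ-≤ m k≤l)) {β} {β′} eq-β
    with refl ← replicate-length {u} {u′} eq-u
    with refl ← replicate-length {v} {v′} eq-v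
    with refl ← descending-unique dΓ dΓ′ eq-Γ
    = refl

  shift₂ : ∀ (as bs : List ℕ) {cs x} → as ++ bs ++ x ∷ cs ↭ x ∷ as ++ bs ++ cs
  shift₂ as bs {cs} {x} = ↭-trans (++⁺ˡ as (shift x bs cs)) (shift x as (bs ++ cs))

  shift₃ : ∀ (as bs cs : List ℕ) {ds x} → as ++ bs ++ cs ++ x ∷ ds ↭ x ∷ as ++ bs ++ cs ++ ds
  shift₃ as bs cs {ds} {x} = ↭-trans (++⁺ˡ as (++⁺ˡ bs (shift x cs ds))) (shift₂ as bs)

  shift₄ : ∀ (as bs cs ds : List ℕ) {es x} → as ++ bs ++ cs ++ ds ++ x ∷ es ↭ x ∷ as ++ bs ++ cs ++ ds ++ es
  shift₄ as bs cs ds {es} {x} = ↭-trans (++⁺ˡ as (++⁺ˡ bs (++⁺ˡ cs (shift x ds es)))) (shift₃ as bs cs)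

  -- A new largest part is encoded by its distance to the previous largest one. For empty `gs` the
  -- value `suc (sum gs)` is 1, the least admissible part.
  cons-gap : ∀ {k} gs → suc (sum gs) ≤ k → partsOf ((k ∸ suc (sum gs)) ∷ gs) ≡ k ∷ partsOf gs
  cons-gap {k} gs top≤k = cong (_∷ partsOf gs) (trans (sym (+-suc (k ∸ suc (sum gs)) (sum gs))) (m∸n+n≡m top≤k))

  -- Parts are inserted from the smallest to the largest. Each new part is therefore the largest of
  -- its class so far and only prepends a gap, increments a counter or prepends an entry.
  contents-surjective : ∀ {ps} → Descending ps → All (2 ≤_) ps → ∃ λ P → Valid P × contents P ↭ ps
  contents-surjective [] [] = profile [] [] 0 0 [] , (inj₂ refl , inj₂ refl , [] , []) , ↭-refl
  contents-surjective {x ∷ xs} (xs≤x ∷ desc) (2≤x ∷ big)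
    with profile α β u v Γ , ok@(u-ok , v-ok , Γ-ok , dΓ) , eq ← contents-surjective desc big
    with x % m ≟ 0 | x % m ≟ 1 | x ≟ 2 | x ≟ 3
  ... | yes x%m≡0 | _ | _ | _ =
    profile ((x / m ∸ suc (sum α)) ∷ α) β u v Γ , ok ,
    ↭-trans (↭-reflexive (cong (λ ks → map (_* m) ks ++ successors β ++ replicate u 2 ++ replicate v 3 ++ Γ) (cons-gap α top≤)))
            (subst (λ y → y ∷ contents (profile α β u v Γ) ↭ x ∷ xs) x≡km (prep x eq))
    where
    x≡km : x ≡ x / m * m
    x≡km = trans (m≡m%n+[m/n]*n x m) (cong (_+ x / m * m) x%m≡0)
    1≤k : 1 ≤ x / m
    1≤k with x / m | x≡km
    ... | suc k | _ = s≤s z≤n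
    ... | zero | refl = contradiction 2≤x λ ()
    top≤ : suc (sum α) ≤ x / m
    top≤ = largest-≤ α 1≤k (All.map (λ {k} km≤x → *-cancelʳ-≤ k (x / m) m (≤-trans km≤x (≤-reflexive x≡km)))
             (All.map⁻ (All.++⁻ˡ (multiples α) (All-resp-↭ (↭-sym eq) xs≤x))))
  ... | no x%m≢0 | yes x%m≡1 | _ | _ =
    profile α ((x / m ∸ suc (sum β)) ∷ β) u v Γ , ok ,
    ↭-trans (↭-reflexive (cong (λ ks → multiples α ++ map (λ k → suc (k * m)) ks ++ replicate u 2 ++ replicate v 3 ++ Γ) (cons-gap β top≤)))
            (↭-trans (shift (suc (x / m * m)) (multiples α) _)
              (subst (λ y → y ∷ contents (profile α β u v Γ) ↭ x ∷ xs) x≡1+km (prep x eq)))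
    where
    x≡1+km : x ≡ suc (x / m * m)
    x≡1+km = trans (m≡m%n+[m/n]*n x m) (cong (_+ x / m * m) x%m≡1)
    1≤k : 1 ≤ x / m
    1≤k with x / m | x≡1+km
    ... | suc k | _ = s≤s z≤n
    ... | zero | refl = contradiction 2≤x λ { (s≤s ()) }
    top≤ : suc (sum β) ≤ x / m
    top≤ = largest-≤ β 1≤k (All.map (λ {k} km≤x → *-cancelʳ-≤ k (x / m) m (≤-pred (≤-trans km≤x (≤-reflexive x≡1+km))))
             (All.map⁻ (All.++⁻ˡ (successors β) (All.++⁻ʳ (multiples α) (All-resp-↭ (↭-sym eq) xs≤x)))))
  ... | no x%m≢0 | no _ | yes refl | _ =
    profile α β (suc u) v Γ , (inj₁ (≤∧≢⇒< 2≤m λ { refl → x%m≢0 refl }) , v-ok , Γ-ok , dΓ) ,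
    ↭-trans (shift₂ (multiples α) (successors β) {replicate u 2 ++ replicate v 3 ++ Γ}) (prep 2 eq)
  ... | no x%m≢0 | no x%m≢1 | no _ | yes refl =
    profile α β u (suc v) Γ ,
    (u-ok , inj₁ (≤∧≢⇒< (≤∧≢⇒< 2≤m λ { refl → x%m≢1 refl }) λ { refl → x%m≢0 refl }) , Γ-ok , dΓ) ,
    ↭-trans (shift₃ (multiples α) (successors β) (replicate u 2) {replicate v 3 ++ Γ}) (prep 3 eq)
  ... | no x%m≢0 | no x%m≢1 | no x≢2 | no x≢3 =
    profile α β u v (x ∷ Γ) ,
    (u-ok , v-ok , ((x%m≢0 , x%m≢1) , ≤∧≢⇒< (≤∧≢⇒< 2≤x (x≢2 ∘ sym)) (x≢3 ∘ sym)) ∷ Γ-ok ,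
      All.++⁻ʳ (replicate v 3) (All.++⁻ʳ (replicate u 2) (All.++⁻ʳ (successors β) (All.++⁻ʳ (multiples α) (All-resp-↭ (↭-sym eq) xs≤x)))) ∷ dΓ) ,
    ↭-trans (shift₄ (multiples α) (successors β) (replicate u 2) (replicate v 3) {Γ}) (prep x eq)

  countCong-++ : ∀ r xs ys → countCong m r (xs ++ ys) ≡ countCong m r xs + countCong m r ys
  countCong-++ r [] ys = refl
  countCong-++ r (x ∷ xs) ys with (x % m) ≡ᵇ (r % m)
  ... | true = cong suc (countCong-++ r xs ys)
  ... | false = countCong-++ r xs ys

  countCong-↭ : ∀ r {xs ys} → xs ↭ ys → countCong m r xs ≡ countCong m r ys
  countCong-↭ r Perm.refl = refl
  countCong-↭ r (prep x eq) with (x % m) ≡ᵇ (r % m)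
  ... | true = cong suc (countCong-↭ r eq)
  ... | false = countCong-↭ r eq
  countCong-↭ r (swap x y eq) with (x % m) ≡ᵇ (r % m) | (y % m) ≡ᵇ (r % m)
  ... | true | true = cong (suc ∘ suc) (countCong-↭ r eq)
  ... | true | false = cong suc (countCong-↭ r eq)
  ... | false | true = cong suc (countCong-↭ r eq)
  ... | false | false = countCong-↭ r eq
  countCong-↭ r (Perm.trans eq eq′) = trans (countCong-↭ r eq) (countCong-↭ r eq′)

  countCong-all : ∀ r {xs} → All (λ x → x % m ≡ r % m) xs → countCong m r xs ≡ length xs
  countCong-all r [] = refl
  countCong-all r {x ∷ xs} (eq ∷ eqs) with (x % m) ≡ᵇ (r % m) in test
  ... | true = cong suc (countCong-all r eqs)
  ... | false = contradiction (subst T test (≡⇒≡ᵇ _ _ eq)) λ ()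

  countCong-none : ∀ r {xs} → All (λ x → x % m ≢ r % m) xs → countCong m r xs ≡ 0
  countCong-none r [] = refl
  countCong-none r {x ∷ xs} (neq ∷ neqs) with (x % m) ≡ᵇ (r % m) in test
  ... | true = contradiction (≡ᵇ⇒≡ _ _ (subst T (sym test) _)) neq
  ... | false = countCong-none r neqs

  0%m≡0 : 0 % m ≡ 0
  0%m≡0 = m<n⇒m%n≡m (≤-trans (s≤s z≤n) 2≤m)

  countCong-0-contents : ∀ P → Valid P → countCong m 0 (contents P) ≡ length (Profile.α P)
  countCong-0-contents P@(profile α β u v Γ) ok = begin
    countCong m 0 (multiples α ++ _)                     ≡⟨ countCong-++ 0 (multiples α) _ ⟩
    countCong m 0 (multiples α) + _                      ≡⟨ cong₂ _+_ (countCong-all 0 (All.map (λ ≡0 → trans ≡0 (sym 0%m≡0)) (multiples-0 α)))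
                                                              (countCong-none 0 (All.++⁺ (All.map (λ ≡1 ≡0 → contradiction (trans (sym ≡1) (trans ≡0 0%m≡0)) λ ()) (successors-1 β))
                                                                (All.map (λ (≢0 , _) ≡0 → ≢0 (trans ≡0 0%m≡0)) (residual-neither P ok)))) ⟩
    length (multiples α) + 0                             ≡⟨ +-identityʳ _ ⟩
    length (multiples α)                                 ≡⟨ length-map _ (partsOf α) ⟩
    length (partsOf α)                                   ≡⟨ length-partsOf α ⟩
    length α                                             ∎
    where open ≡-Reasoning

  countCong-1-contents : ∀ P → Valid P → countCong m 1 (contents P) ≡ length (Profile.β P)
  countCong-1-contents P@(profile α β u v Γ) ok = begin
    countCong m 1 (multiples α ++ _)                     ≡⟨ countCong-++ 1 (multiples α) _ ⟩
    countCong m 1 (multiples α) + _                      ≡⟨ cong (_+ _) (countCong-none 1 (All.map (λ ≡0 ≡1 → contradiction (trans (sym ≡0) (trans ≡1 1%m≡1)) λ ()) (multiples-0 α))) ⟩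
    countCong m 1 (successors β ++ _)                    ≡⟨ countCong-++ 1 (successors β) _ ⟩
    countCong m 1 (successors β) + _                     ≡⟨ cong₂ _+_ (countCong-all 1 (All.map (λ ≡1 → trans ≡1 (sym 1%m≡1)) (successors-1 β)))
                                                              (countCong-none 1 (All.map (λ (_ , ≢1) ≡1 → ≢1 (trans ≡1 1%m≡1)) (residual-neither P ok))) ⟩
    length (successors β) + 0                            ≡⟨ +-identityʳ _ ⟩
    length (successors β)                                ≡⟨ length-map _ (partsOf β) ⟩
    length (partsOf β)                                   ≡⟨ length-partsOf β ⟩
    length β                                             ∎
    where open ≡-Reasoning

  sum-multiples : ∀ gs → sum (multiples gs) ≡ energy gs * m
  sum-multiples [] = refl
  sum-multiples (g ∷ gs) = begin
    suc (g + sum gs) * m + sum (multiples gs)   ≡⟨ cong (suc (g + sum gs) * m +_) (sum-multiples gs) ⟩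
    suc (g + sum gs) * m + energy gs * m        ≡⟨ *-distribʳ-+ m (suc (g + sum gs)) (energy gs) ⟨
    (suc (g + sum gs) + energy gs) * m          ∎
    where open ≡-Reasoning

  sum-successors : ∀ gs → sum (successors gs) ≡ energy gs * m + length gs
  sum-successors [] = refl
  sum-successors (g ∷ gs) = begin
    suc (x * m) + sum (successors gs)                  ≡⟨ cong (suc (x * m) +_) (sum-successors gs) ⟩
    suc (x * m) + (energy gs * m + length gs)          ≡⟨ rearrange m x (energy gs) (length gs) ⟩
    (x + energy gs) * m + suc (length gs)              ∎
    where
    open ≡-Reasoning
    x : ℕ
    x = suc (g + sum gs)
    rearrange : ∀ m x e l → suc (x * m) + (e * m + l) ≡ (x + e) * m + suc l
    rearrange = solve-∀

  sum-contents : ∀ P → sum (contents P) ≡ weight P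
  sum-contents (profile α β u v Γ)
    rewrite sum-++ (multiples α) (successors β ++ replicate u 2 ++ replicate v 3 ++ Γ)
          | sum-++ (successors β) (replicate u 2 ++ replicate v 3 ++ Γ)
          | sum-++ (replicate u 2) (replicate v 3 ++ Γ)
          | sum-++ (replicate v 3) Γ
          | sum-replicate u 2 | sum-replicate v 3
          | sum-multiples α | sum-successors β = refl

  contents-≥2 : ∀ P → Valid P → All (2 ≤_) (contents P)
  contents-≥2 (profile α β u v Γ) (_ , _ , Γ-ok , _) =
    All.++⁺ (All.map⁺ (All.map (λ {k} 1≤k → ≤-trans 2≤m (≤-trans (≤-reflexive (sym (*-identityˡ m))) (*-monoˡ-≤ m 1≤k))) (partsOf-positive α)))
    (All.++⁺ (All.map⁺ (All.map (λ {k} 1≤k → ≤-trans 2≤m (≤-trans (≤-reflexive (sym (*-identityˡ m))) (≤-trans (*-monoˡ-≤ m 1≤k) (n≤1+n _)))) (partsOf-positive β)))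
    (All.++⁺ (All.replicate⁺ u (s≤s (s≤s z≤n)))
    (All.++⁺ (All.replicate⁺ v (s≤s (s≤s z≤n)))
      (All.map (λ (_ , 4≤x) → ≤-trans (s≤s (s≤s z≤n)) 4≤x) Γ-ok))))

  open import Data.List.Sort (Flip.decTotalOrder ≤-decTotalOrder) using (sort; sort-↭; sort-↗)

  -- The injection is given by indices, each with a source and a target profile, so that it never
  -- has to be computed from a partition. Surjectivity onto the biased profiles makes it total, and
  -- the missed profile `W` makes the inequality strict.
  biased-<-by-injection : ∀ {n} {I : Set} (source target : I → Profile) →
    (∀ i j → target i ≡ target j → source i ≡ source j) →
    (∀ P → Valid P → weight P ≡ n → length (Profile.α P) < length (Profile.β P) →
      ∃ λ i → source i ≡ P × Valid (target i) × weight (target i) ≡ n ×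
              length (Profile.β (target i)) < length (Profile.α (target i))) →
    ∀ W → Valid W → weight W ≡ n → length (Profile.β W) < length (Profile.α W) → (∀ i → target i ≢ W) →
    q 1 0 m n < q 0 1 m n
  biased-<-by-injection {n} {I} source target injective cover W W-ok W-weight W-bias missed =
    length-<-by-injection Related related-injective (biased 1 0 m n) (biased 0 1 m n) (biased-unique 1 0 m n)
      image (listed W W-ok W-weight W-bias) λ _ (i , _ , _ , i-ok , _ , eq) → missed i
        (contents-injective i-ok W-ok (↭-trans (↭-sym eq) (sort-↭ (contents W))))
    where
    Related : List ℕ → List ℕ → Set
    Related ps qs = ∃ λ i → Descending ps × Valid (source i) × Valid (target i) × contents (source i) ↭ ps × qs ↭ contents (target i)
    related-injective : ∀ {ps ps′ qs} → Related ps qs → Related ps′ qs → ps ≡ ps′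
    related-injective (i , desc , _ , ok , eq , eqt) (j , desc′ , _ , ok′ , eq′ , eqt′) =
      descending-unique desc desc′ (↭-trans (↭-sym eq)
        (subst (λ P → contents P ↭ _) (sym (injective i j (contents-injective ok ok′ (↭-trans (↭-sym eqt) eqt′)))) eq′))
    listed : ∀ P → Valid P → weight P ≡ n → length (Profile.β P) < length (Profile.α P) → sort (contents P) ∈ biased 0 1 m n
    listed P ok total bias = ∈-biased⁺ 0 1 m n
      ( Sorted⇒AllPairs (DecTotalOrder.totalOrder (Flip.decTotalOrder ≤-decTotalOrder)) (sort-↗ (contents P))
      , All-resp-↭ (↭-sym (sort-↭ (contents P))) (contents-≥2 P ok)
      , trans (sum-↭ (sort-↭ (contents P))) (trans (sum-contents P) total)
      , subst₂ _<_ (sym (trans (countCong-↭ 1 (sort-↭ (contents P))) (countCong-1-contents P ok)))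
                   (sym (trans (countCong-↭ 0 (sort-↭ (contents P))) (countCong-0-contents P ok))) bias)
    image : ∀ {ps} → ps ∈ biased 1 0 m n → ∃ λ qs → qs ∈ biased 0 1 m n × Related ps qs
    image ps∈
      with desc , big , total , bias ← ∈-biased⁻ 1 0 m n ps∈
      with P , ok , eq ← contents-surjective desc big
      with i , refl , ok′ , total′ , bias′ ← cover P ok
        (trans (sym (sum-contents P)) (trans (sum-↭ eq) total))
        (subst₂ _<_ (trans (sym (countCong-↭ 0 eq)) (countCong-0-contents P ok))
                    (trans (sym (countCong-↭ 1 eq)) (countCong-1-contents P ok)) bias)
      = sort (contents (target i)) , listed (target i) ok′ total′ bias′ ,
        i , desc , ok , ok′ , eq , sort-↭ (contents (target i))

-- Arithmetic of gap lists, remainders and parity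

energy-++ : ∀ xs ys → energy (xs ++ ys) ≡ energy xs + (length xs * sum ys + energy ys)
energy-++ [] ys = refl
energy-++ (x ∷ xs) ys rewrite sum-++ xs ys | energy-++ xs ys = rearrange x (sum xs) (sum ys) (energy xs) (length xs) (energy ys)
  where
  rearrange : ∀ x Sx Sy Ex l Ey → suc (x + (Sx + Sy)) + (Ex + (l * Sy + Ey)) ≡ suc (x + Sx) + Ex + (Sy + l * Sy + Ey)
  rearrange = solve-∀

energy-zeros : ∀ k → energy (replicate k 0) ≡ k
energy-zeros zero = refl
energy-zeros (suc k) rewrite energy-zeros k | sum-replicate k 0 | *-zeroʳ k = refl

energy-++-zeros : ∀ xs k → energy (xs ++ replicate k 0) ≡ energy xs + k
energy-++-zeros xs k rewrite energy-++ xs (replicate k 0) | energy-zeros k | sum-replicate k 0 | *-zeroʳ k | *-zeroʳ (length xs) = refl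

-- In terms of partitions, appending the gap i raises every part by i and adds a smallest part 1 + i.
energy-∷ʳ : ∀ xs i → energy (xs ++ [ i ]) ≡ energy xs + suc (i + length xs * i)
energy-∷ʳ xs i rewrite energy-++ xs [ i ] = rearrange (energy xs) (length xs) i
  where
  rearrange : ∀ e l i → e + (l * (i + 0) + (suc (i + 0) + 0)) ≡ e + suc (i + l * i)
  rearrange = solve-∀

sum-++-zeros : ∀ xs k → sum (xs ++ replicate k 0) ≡ sum xs
sum-++-zeros xs k rewrite sum-++ xs (replicate k 0) | sum-replicate k 0 | *-zeroʳ k = +-identityʳ (sum xs)

length-++-zeros : ∀ (xs : List ℕ) k → length (xs ++ replicate k 0) ≡ length xs + k
length-++-zeros xs k = trans (length-++ xs) (cong (length xs +_) (length-replicate k))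

length-∷ʳ : ∀ (xs : List ℕ) i → length (xs ++ [ i ]) ≡ suc (length xs)
length-∷ʳ xs i = trans (length-++ xs) (+-comm (length xs) 1)

++-injective : ∀ {xs ys us vs : List ℕ} → length xs ≡ length ys → xs ++ us ≡ ys ++ vs → xs ≡ ys × us ≡ vs
++-injective {[]} {[]} _ eq = refl , eq
++-injective {x ∷ xs} {y ∷ ys} len eq
  with refl , eq′ ← ∷-injective eq
  with refl , us≡vs ← ++-injective {xs} {ys} (suc-injective len) eq′ = refl , us≡vs

replicate-injective : ∀ {k l} {x : ℕ} → replicate k x ≡ replicate l x → k ≡ l
replicate-injective {k} {l} eq = trans (sym (length-replicate k)) (trans (cong length eq) (length-replicate l))

quotient-remainder-injective : ∀ a .{{_ : NonZero a}} {i j i′ j′} → j < a → j′ < a → j + i * a ≡ j′ + i′ * a → i ≡ i′ × j ≡ j′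
quotient-remainder-injective a {i} {j} {i′} {j′} j<a j′<a eq = *-cancelʳ-≡ i i′ a (+-cancelˡ-≡ j _ _ (trans eq (cong (_+ i′ * a) (sym j≡j′)))) , j≡j′
  where
  j≡j′ : j ≡ j′
  j≡j′ = begin
    j                  ≡⟨ m<n⇒m%n≡m j<a ⟨
    j % a              ≡⟨ [m+kn]%n≡m%n j i a ⟨
    (j + i * a) % a    ≡⟨ cong (_% a) eq ⟩
    (j′ + i′ * a) % a  ≡⟨ [m+kn]%n≡m%n j′ i′ a ⟩
    j′ % a             ≡⟨ m<n⇒m%n≡m j′<a ⟩
    j′                 ∎
    where open ≡-Reasoning

parity : ∀ n → ∃ λ k → n ≡ k * 2 ⊎ n ≡ suc (k * 2)
parity zero = 0 , inj₁ refl
parity (suc n) with parity n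
... | k , inj₁ refl = k , inj₂ refl
... | k , inj₂ refl = suc k , inj₁ refl

half-even : ∀ k → ⌊ k * 2 /2⌋ ≡ k
half-even zero = refl
half-even (suc k) = cong suc (half-even k)

half-odd : ∀ k → ⌊ suc (k * 2) /2⌋ ≡ k
half-odd zero = refl
half-odd (suc k) = cong suc (half-odd k)

isEven : ℕ → Bool
isEven zero = true
isEven (suc zero) = false
isEven (suc (suc n)) = isEven n

isEven-even : ∀ k → isEven (k * 2) ≡ true
isEven-even zero = refl
isEven-even (suc k) = isEven-even k

isEven-odd : ∀ k → isEven (suc (k * 2)) ≡ false
isEven-odd zero = refl
isEven-odd (suc k) = isEven-odd k

<ᵇ-true : ∀ {m n} → m < n → (m <ᵇ n) ≡ true
<ᵇ-true {m} {n} m<n with m <ᵇ n in eq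
... | true = refl
... | false = contradiction (subst T eq (<⇒<ᵇ m<n)) λ ()

<ᵇ-false : ∀ {m n} → n ≤ m → (m <ᵇ n) ≡ false
<ᵇ-false {m} {n} n≤m with m <ᵇ n in eq
... | false = refl
... | true = contradiction (<ᵇ⇒< m n (subst T (sym eq) _)) (≤⇒≯ n≤m)

-- The case m = 2

module ModulusTwo where

  open Profiles 2 ≤-refl

  -- Kind names the cases of the injection; kind recovers the case from the image.
  data Kind : Set where
    swapped moved single pair₁ pair₂ pairᵒ pairᵉ appended spread none : Kind

  -- The excess of ones is 2 + 2 e for `swapped`, 3 + 2 e for `moved`, and 1 otherwise. With excess
  -- 1, `single` has no zeros, the four pairs have one zero, and `appended` and `spread` have at
  -- least two, the smallest being `(i + 1) * 2`.
  data Index : Kind → Set where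
    swapped  : ∀ (e h : ℕ) (t s : List ℕ) → length t ≡ length s + suc (e * 2) → Index swapped
    moved    : ∀ (e h : ℕ) (t : List ℕ) (i : ℕ) (s : List ℕ) → length t ≡ length s + suc (e * 2) → Index moved
    single   : (k : ℕ) → Index single
    pair₁    : (h w : ℕ) → Index pair₁
    pair₂    : (h w : ℕ) → Index pair₂
    pairᵒ    : (x h w : ℕ) → Index pairᵒ
    pairᵉ    : (x h w : ℕ) → Index pairᵉ
    appended : ∀ (g j : ℕ) (t : List ℕ) (i x : ℕ) (s : List ℕ) → length t ≡ suc (suc (length s)) →
               j ≤ suc (length s) → g ≤ suc ⌊ suc j /2⌋ → Index appended
    spread   : ∀ (z : ℕ) (t : List ℕ) (i x : ℕ) (s : List ℕ) → length t ≡ suc (suc (length s)) → Index spread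

  source : ∀ {k} → Index k → Profile
  source (swapped e h t s _) = profile s (h ∷ t) 0 0 []
  source (moved e h t i s _) = profile s (h ∷ (t ++ [ i ])) 0 0 []
  source (single k) = profile [] [ 2 + k ] 0 0 []
  source (pair₁ h w) = profile [ 0 ] (h ∷ w ∷ []) 0 0 []
  source (pair₂ h w) = profile [ 1 ] (h ∷ w ∷ []) 0 0 []
  source (pairᵒ x h w) = profile [ 2 + x * 2 ] (h ∷ w ∷ []) 0 0 []
  source (pairᵉ x h w) = profile [ 3 + x * 2 ] (h ∷ w ∷ []) 0 0 []
  source (appended g j t i x s _ _ _) = profile ((x ∷ s) ++ [ i ]) ((g + j) ∷ t) 0 0 []
  source (spread z t i x s _) = profile ((x ∷ s) ++ [ i ]) ((4 + length s + z) ∷ t) 0 0 []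

  target : ∀ {k} → Index k → Profile
  target (swapped e h t s _) = profile ((h + suc e) ∷ t) s 0 0 []
  -- The last gap `i` was counted in `length t + 2` ones and is now counted in `length s + 1`. The
  -- `2 + e * 2` lost copies of it go into the largest zero, together with the `suc e` units that
  -- make up for the exchange.
  target (moved e h t i s _) = profile ((h + (i * (2 + e * 2) + suc e)) ∷ t) (s ++ [ i ]) 0 0 []
  target (single k) = profile (0 ∷ 0 ∷ []) [ k ] 0 0 []
  target (pair₁ h w) = profile (suc h ∷ w ∷ 0 ∷ []) [] 0 0 []
  target (pair₂ h w) = profile (h ∷ w ∷ 0 ∷ 0 ∷ 0 ∷ []) [] 0 0 []
  target (pairᵒ x h w) = profile (0 ∷ x ∷ 0 ∷ []) (h ∷ w ∷ []) 0 0 []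
  target (pairᵉ x h w) = profile (0 ∷ x ∷ 0 ∷ 0 ∷ []) (h ∷ w ∷ []) 0 0 []
  -- The new zeros are parts 2. Dissolving the smallest zero frees `1 + i * (2 + length s)` units of
  -- 2, having two ones fewer frees one more, and `j` are taken from the largest gap. Since `j` is
  -- less than `2 + length s`, it is recovered as a remainder and `i` as a quotient.
  target (appended g j t i x s _ _ _) = profile (g ∷ (t ++ replicate (2 + (j + i * suc (suc (length s)))) 0)) (x ∷ s) 0 0 []
  -- A large first gap is cleared altogether. The gap 1 raises every zero up to its own by one unit;
  -- its position records `i`, and the number of zeros after it then gives `z`.
  target (spread z t i x s _) = profile (0 ∷ (t ++ (replicate i 0 ++ 1 ∷ replicate (suc (z + i * length s)) 0))) (x ∷ s) 0 0 []

  -- The image of `single` has two parts 2 as its zeros; the missed partition for odd `n` has two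
  -- parts 4 instead.
  kind-single : List ℕ → Kind
  kind-single (0 ∷ _) = single
  kind-single _ = none

  kind-low : ℕ → List ℕ → List ℕ → Kind
  kind-low 0 t [] = kind-single t
  kind-low 0 _ (_ ∷ _) = pairᵒ
  kind-low 1 _ _ = pairᵉ
  -- The first `2 + length s` gaps come from the ones of the source. Behind them `appended` has only
  -- gaps 0, while `spread` has a gap 1.
  kind-low (suc (suc _)) t s = if isZero (sum (drop (2 + length s) t)) then appended else spread
    where
    isZero : ℕ → Bool
    isZero n = n ≡ᵇ 0

  -- An exchange with parameter `e` yields `δ` equal to 2 e + 1 or 2 e and a first gap of at least e
  -- + 1, which exceeds `⌊ δ /2⌋`; the parity of `δ` separates the two exchanges. All other images
  -- have a first gap of at most `⌊ δ /2⌋`.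
  kind-nonempty : ℕ → ℕ → List ℕ → List ℕ → Kind
  kind-nonempty δ h t s =
    if ⌊ δ /2⌋ <ᵇ h then (if isEven δ then moved else swapped) else kind-low δ t s

  -- Without ones in the image, `swapped` gives an odd number of zeros besides the largest, and
  -- `moved` does not occur. The values 2 and 4 are thus free for the pairs, and 0 for the missed
  -- partition into a single part.
  kind-empty : ℕ → Kind
  kind-empty 0 = none
  kind-empty 2 = pair₁
  kind-empty 4 = pair₂
  kind-empty _ = swapped

  kind : Profile → Kind
  kind (profile [] _ _ _ _) = none
  kind (profile (h ∷ t) [] _ _ _) = kind-empty (length t)
  kind (profile (h ∷ t) (x ∷ s) _ _ _) = kind-nonempty (length t ∸ suc (length s)) h t s

  kind-empty-odd : ∀ e → kind-empty (suc (e * 2)) ≡ swapped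
  kind-empty-odd 0 = refl
  kind-empty-odd 1 = refl
  kind-empty-odd (suc (suc e)) = refl

  kind-swapped : ∀ e h t s → kind-nonempty (suc (e * 2)) (h + suc e) t s ≡ swapped
  kind-swapped e h t s rewrite half-odd e | <ᵇ-true (m≤n+m (suc e) h) | isEven-odd e = refl

  kind-moved : ∀ e h t s → kind-nonempty (e * 2) (h + suc e) t s ≡ moved
  kind-moved e h t s rewrite half-even e | <ᵇ-true (m≤n+m (suc e) h) | isEven-even e = refl

  drop-++ : ∀ {n} (xs ys : List ℕ) → length xs ≡ n → drop n (xs ++ ys) ≡ ys
  drop-++ [] ys refl = refl
  drop-++ (x ∷ xs) ys refl = drop-++ xs ys refl

  kind-target : ∀ {k} (p : Index k) → kind (target p) ≡ k
  kind-target (swapped e h t [] len) rewrite len = kind-empty-odd e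
  kind-target (swapped e h t (x ∷ s) len) rewrite len | m+n∸m≡n (length s) (suc (e * 2)) = kind-swapped e h t s
  kind-target (moved e h t i [] len) rewrite len | sym (+-assoc h (i * (2 + e * 2)) (suc e)) = kind-moved e (h + i * (2 + e * 2)) t []
  kind-target (moved e h t i (x ∷ s) len) rewrite len | length-∷ʳ s i | +-suc (length s) (e * 2) | m+n∸m≡n (length s) (e * 2)
    | sym (+-assoc h (i * (2 + e * 2)) (suc e)) = kind-moved e (h + i * (2 + e * 2)) t (s ++ [ i ])
  kind-target (single k) = refl
  kind-target (pair₁ h w) = refl
  kind-target (pair₂ h w) = refl
  kind-target (pairᵒ x h w) = refl
  kind-target (pairᵉ x h w) = refl
  kind-target (appended g j t i x s len j≤ g≤)
    rewrite length-++-zeros t (2 + (j + i * suc (suc (length s)))) | len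
          | sym (+-suc (length s) (2 + (j + i * suc (suc (length s))))) | m+n∸m≡n (length s) (3 + (j + i * suc (suc (length s))))
          | <ᵇ-false {suc ⌊ suc (j + i * suc (suc (length s))) /2⌋} {g} (≤-trans g≤ (s≤s (⌊n/2⌋-mono (s≤s (m≤m+n j _)))))
          | drop-++ t (replicate (2 + (j + i * suc (suc (length s)))) 0) len
          | sum-replicate (j + i * suc (suc (length s))) 0 | *-zeroʳ (j + i * suc (suc (length s))) = refl
  kind-target (spread z t i x s len)
    rewrite length-++ t {replicate i 0 ++ 1 ∷ replicate (suc (z + i * length s)) 0} | len
          | length-++ (replicate i 0) {1 ∷ replicate (suc (z + i * length s)) 0}
          | length-replicate i {0} | length-replicate (z + i * length s) {0}
          | +-suc i (suc (z + i * length s)) | +-suc i (z + i * length s)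
          | sym (+-suc (length s) (2 + (i + (z + i * length s)))) | m+n∸m≡n (length s) (3 + (i + (z + i * length s)))
          | drop-++ t (replicate i 0 ++ 1 ∷ replicate (suc (z + i * length s)) 0) len
          | sum-++ (replicate i 0) (1 ∷ replicate (suc (z + i * length s)) 0)
          | sum-replicate i 0 | *-zeroʳ i = refl

  zeros-then-one-injective : ∀ i i′ {xs ys} → replicate i 0 ++ 1 ∷ xs ≡ replicate i′ 0 ++ 1 ∷ ys → i ≡ i′ × xs ≡ ys
  zeros-then-one-injective zero zero eq = refl , ∷-injectiveʳ eq
  zeros-then-one-injective (suc i) (suc i′) eq with refl , eq′ ← zeros-then-one-injective i i′ (∷-injectiveʳ eq) = refl , eq′

  α-injective : ∀ {α α′ β β′} → profile α β 0 0 [] ≡ profile α′ β′ 0 0 [] → α ≡ α′ × β ≡ β′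
  α-injective refl = refl , refl

  target-injective : ∀ {k} (p p′ : Index k) → target p ≡ target p′ → source p ≡ source p′
  target-injective (swapped e h t s len) (swapped e′ h′ t′ s′ len′) eq
    with eqα , refl ← α-injective eq
    with eqh , refl ← ∷-injective eqα
    with refl ← *-cancelʳ-≡ e e′ 2 (suc-injective (+-cancelˡ-≡ (length s) _ _ (trans (sym len) len′)))
    with refl ← +-cancelʳ-≡ (suc e) h h′ eqh = refl
  target-injective (moved e h t i s len) (moved e′ h′ t′ i′ s′ len′) eq
    with eqα , eqβ ← α-injective eq
    with refl , refl ← ∷ʳ-injective s s′ eqβ
    with eqh , refl ← ∷-injective eqα
    with refl ← *-cancelʳ-≡ e e′ 2 (suc-injective (+-cancelˡ-≡ (length s) _ _ (trans (sym len) len′)))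
    with refl ← +-cancelʳ-≡ (i * (2 + e * 2) + suc e) h h′ eqh = refl
  target-injective (single k) (single .k) refl = refl
  target-injective (pair₁ h w) (pair₁ .h .w) refl = refl
  target-injective (pair₂ h w) (pair₂ .h .w) refl = refl
  target-injective (pairᵒ x h w) (pairᵒ .x .h .w) refl = refl
  target-injective (pairᵉ x h w) (pairᵉ .x .h .w) refl = refl
  target-injective (appended g j t i x s len j≤ g≤) (appended g′ j′ t′ i′ x′ s′ len′ j≤′ g≤′) eq
    with eqα , refl ← α-injective eq
    with refl , eqt ← ∷-injective eqα
    with refl , eqz ← ++-injective {t} {t′} (trans len (sym len′)) eqt
    with refl , refl ← quotient-remainder-injective (suc (suc (length s))) {i} {j} {i′} {j′} (s≤s j≤) (s≤s j≤′)
      (suc-injective (suc-injective (replicate-injective {x = 0} eqz))) = refl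
  target-injective (spread z t i x s len) (spread z′ t′ i′ x′ s′ len′) eq
    with eqα , refl ← α-injective eq
    with refl , eqz ← ++-injective {t} {t′} (trans len (sym len′)) (∷-injectiveʳ eqα)
    with refl , eqr ← zeros-then-one-injective i i′ eqz
    with refl ← +-cancelʳ-≡ (i * length s) z z′ (suc-injective (replicate-injective {x = 0} eqr)) = refl

  energy-zeros-then-one : ∀ i r → energy (replicate i 0 ++ 1 ∷ replicate r 0) ≡ i * 2 + (2 + r)
  energy-zeros-then-one i r
    rewrite energy-++ (replicate i 0) (1 ∷ replicate r 0) | energy-zeros i | energy-zeros r | length-replicate i {0} | sum-replicate r 0 | *-zeroʳ r = rearrange i r
    where
    rearrange : ∀ i r → i + (i * 1 + (2 + r)) ≡ i * 2 + (2 + r)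
    rearrange = solve-∀

  sum-zeros-then-one : ∀ i r → sum (replicate i 0 ++ 1 ∷ replicate r 0) ≡ 1
  sum-zeros-then-one i r rewrite sum-++ (replicate i 0) (1 ∷ replicate r 0) | sum-replicate i 0 | *-zeroʳ i | sum-replicate r 0 | *-zeroʳ r = refl

  weight-target : ∀ {k} (p : Index k) → weight (target p) ≡ weight (source p)
  weight-target (swapped e h t s len) rewrite len = rearrange e h (sum t) (energy t) (energy s) (length s)
    where
    rearrange : ∀ e h St Et Es ls → (suc (h + suc e + St) + Et) * 2 + (Es * 2 + ls + 0) ≡ Es * 2 + ((suc (h + St) + Et) * 2 + suc (ls + suc (e * 2)) + 0)
    rearrange = solve-∀
  weight-target (moved e h t i s len)
    rewrite energy-∷ʳ t i | energy-∷ʳ s i | sum-++ t [ i ] | length-∷ʳ t i | length-∷ʳ s i | len = rearrange e h i (sum t) (energy t) (energy s) (length s)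
    where
    rearrange : ∀ e h i St Et Es ls →
      (suc (h + (i * (2 + e * 2) + suc e) + St) + Et) * 2 + ((Es + suc (i + ls * i)) * 2 + suc ls + 0)
      ≡ Es * 2 + ((suc (h + (St + (i + 0))) + (Et + suc (i + (ls + suc (e * 2)) * i))) * 2 + suc (suc (ls + suc (e * 2))) + 0)
    rearrange = solve-∀
  weight-target (single k) = rearrange k
    where
    rearrange : ∀ k → 4 + ((suc (k + 0) + 0) * 2 + 1 + 0) ≡ (suc (2 + k + 0) + 0) * 2 + 1 + 0
    rearrange = solve-∀
  weight-target (pair₁ h w) = rearrange h w
    where
    rearrange : ∀ h w → (suc (suc h + (w + 0)) + (suc (w + 0) + 1)) * 2 + 0 ≡ 2 + ((suc (h + (w + 0)) + (suc (w + 0) + 0)) * 2 + 2 + 0)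
    rearrange = solve-∀
  weight-target (pair₂ h w) = rearrange h w
    where
    rearrange : ∀ h w → (suc (h + (w + 0)) + (suc (w + 0) + 3)) * 2 + 0 ≡ 4 + ((suc (h + (w + 0)) + (suc (w + 0) + 0)) * 2 + 2 + 0)
    rearrange = solve-∀
  weight-target (pairᵒ x h w) = rearrange x h w
    where
    rearrange : ∀ x h w → (suc (x + 0) + (suc (x + 0) + 1)) * 2 + ((suc (h + (w + 0)) + (suc (w + 0) + 0)) * 2 + 2 + 0)
      ≡ (suc (2 + x * 2 + 0) + 0) * 2 + ((suc (h + (w + 0)) + (suc (w + 0) + 0)) * 2 + 2 + 0)
    rearrange = solve-∀
  weight-target (pairᵉ x h w) = rearrange x h w
    where
    rearrange : ∀ x h w → (suc (x + 0) + (suc (x + 0) + 2)) * 2 + ((suc (h + (w + 0)) + (suc (w + 0) + 0)) * 2 + 2 + 0)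
      ≡ (suc (3 + x * 2 + 0) + 0) * 2 + ((suc (h + (w + 0)) + (suc (w + 0) + 0)) * 2 + 2 + 0)
    rearrange = solve-∀
  weight-target (appended g j t i x s len _ _)
    rewrite sum-++-zeros t (2 + (j + i * suc (suc (length s)))) | energy-++-zeros t (2 + (j + i * suc (suc (length s))))
          | sum-++ s [ i ] | energy-∷ʳ s i | len = rearrange g j (sum t) (energy t) i x (sum s) (energy s) (length s)
    where
    rearrange : ∀ g j St Et i x Ss Es ls →
      (suc (g + St) + (Et + (2 + (j + i * (2 + ls))))) * 2 + ((suc (x + Ss) + Es) * 2 + suc ls + 0)
      ≡ (suc (x + (Ss + (i + 0))) + (Es + suc (i + ls * i))) * 2 + ((suc (g + j + St) + Et) * 2 + suc (2 + ls) + 0)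
    rearrange = solve-∀
  weight-target (spread z t i x s len)
    rewrite sum-++ t (replicate i 0 ++ 1 ∷ replicate (suc (z + i * length s)) 0)
          | energy-++ t (replicate i 0 ++ 1 ∷ replicate (suc (z + i * length s)) 0)
          | sum-zeros-then-one i (suc (z + i * length s)) | energy-zeros-then-one i (suc (z + i * length s))
          | sum-++ s [ i ] | energy-∷ʳ s i | len = rearrange z (sum t) (energy t) i x (sum s) (energy s) (length s)
    where
    rearrange : ∀ z St Et i x Ss Es ls →
      (suc (St + 1) + (Et + ((2 + ls) * 1 + (i * 2 + (2 + suc (z + i * ls)))))) * 2 + ((suc (x + Ss) + Es) * 2 + suc ls + 0)
      ≡ (suc (x + (Ss + (i + 0))) + (Es + suc (i + ls * i))) * 2 + ((suc (4 + ls + z + St) + Et) * 2 + suc (2 + ls) + 0)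
    rearrange = solve-∀

  target-biased : ∀ {k} (p : Index k) → length (Profile.β (target p)) < length (Profile.α (target p))
  target-biased (swapped e h t s len) rewrite len = s≤s (m≤m+n _ _)
  target-biased (moved e h t i s len) rewrite length-∷ʳ s i | len | +-suc (length s) (e * 2) = s≤s (s≤s (m≤m+n _ _))
  target-biased (single k) = s≤s (s≤s z≤n)
  target-biased (pair₁ h w) = s≤s z≤n
  target-biased (pair₂ h w) = s≤s z≤n
  target-biased (pairᵒ x h w) = s≤s (s≤s (s≤s z≤n))
  target-biased (pairᵉ x h w) = s≤s (s≤s (s≤s z≤n))
  target-biased (appended g j t i x s len _ _)
    rewrite length-++-zeros t (2 + (j + i * suc (suc (length s)))) | len = s≤s (s≤s (≤-trans (n≤1+n _) (s≤s (m≤m+n _ _))))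
  target-biased (spread z t i x s len)
    rewrite length-++ t {replicate i 0 ++ 1 ∷ replicate (suc (z + i * length s)) 0} | len = s≤s (s≤s (≤-trans (n≤1+n _) (s≤s (m≤m+n _ _))))

  -- A first gap of at most `suc l` can be turned into new zeros entirely. For the next two values,
  -- 1 or 2 units stay behind as `g`, which the bound on `g` allows since `j` is then at least 1.
  -- Beyond that `spread` takes over.
  data GapView (l : ℕ) : ℕ → Set where
    small : ∀ {h} → h ≤ suc l → GapView l h
    plus₂ : GapView l (2 + l)
    plus₃ : GapView l (3 + l)
    large : ∀ z → GapView l (4 + l + z)

  gapView : ∀ l h → GapView l h
  gapView l 0 = small z≤n
  gapView 0 1 = small ≤-refl
  gapView 0 2 = plus₂
  gapView 0 3 = plus₃
  gapView 0 (suc (suc (suc (suc z)))) = large z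
  gapView (suc l) (suc h) with gapView l h
  ... | small h≤ = small (s≤s h≤)
  ... | plus₂ = plus₂
  ... | plus₃ = plus₃
  ... | large z = large z

  Source : Profile → Set
  Source P = ∃₂ λ k (p : Index k) → source p ≡ P

  source-surjective-1 : ∀ h t s → length t ≡ length s → 11 ≤ weight (profile s (h ∷ t) 0 0 []) → Source (profile s (h ∷ t) 0 0 [])
  source-surjective-1 h t s len big with initLast s
  -- A lone part 3 or 5 is excluded by the weight; `single` splits two parts 2 off a part that is at
  -- least 7.
  source-surjective-1 0 [] _ len big | [] = contradiction big (from-no (11 ≤? 3))
  source-surjective-1 1 [] _ len big | [] = contradiction big (from-no (11 ≤? 5))
  source-surjective-1 (suc (suc k)) [] _ len big | [] = _ , single k , refl
  source-surjective-1 h (w ∷ []) _ len big | [] ∷ʳ′ 0 = _ , pair₁ h w , refl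
  source-surjective-1 h (w ∷ []) _ len big | [] ∷ʳ′ 1 = _ , pair₂ h w , refl
  source-surjective-1 h (w ∷ []) _ len big | [] ∷ʳ′ suc (suc i) with parity i
  ... | x , inj₁ refl = _ , pairᵒ x h w , refl
  ... | x , inj₂ refl = _ , pairᵉ x h w , refl
  source-surjective-1 h t _ len big | (x ∷ s) ∷ʳ′ i with gapView (length s) h
  ... | small h≤ = _ , appended 0 h t i x s (trans len (cong suc (length-∷ʳ s i))) h≤ z≤n , refl
  ... | plus₂ = _ , appended 1 (suc (length s)) t i x s (trans len (cong suc (length-∷ʳ s i))) ≤-refl (s≤s z≤n) , refl
  ... | plus₃ = _ , appended 2 (suc (length s)) t i x s (trans len (cong suc (length-∷ʳ s i))) ≤-refl (s≤s (s≤s z≤n)) , refl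
  ... | large z = _ , spread z t i x s (trans len (cong suc (length-∷ʳ s i))) , refl

  source-surjective : ∀ α β → length α < length β → 11 ≤ weight (profile α β 0 0 []) → Source (profile α β 0 0 [])
  source-surjective s (h ∷ t) (s≤s s≤t) big with parity (length t ∸ length s) | m+[n∸m]≡n s≤t
  ... | e , inj₂ eq | len = _ , swapped e h t s (trans (sym len) (cong (length s +_) eq)) , refl
  ... | 0 , inj₁ eq | len = source-surjective-1 h t s (trans (sym len) (trans (cong (length s +_) eq) (+-identityʳ _))) big
  ... | suc e , inj₁ eq | len with initLast t
  ...   | [] = contradiction (trans (sym len) (trans (cong (length s +_) eq) (+-suc _ _))) λ ()
  ...   | t′ ∷ʳ′ i = _ , moved e h t′ i s (suc-injective (trans (sym (length-∷ʳ t′ i)) (trans (sym len) (trans (cong (length s +_) eq) (+-suc _ _))))) , refl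

  valid : Valid (profile [] [] 0 0 [])
  valid = inj₂ refl , inj₂ refl , [] , []

  valid-target : ∀ {k} (p : Index k) → Valid (target p)
  valid-target (swapped _ _ _ _ _) = valid
  valid-target (moved _ _ _ _ _ _) = valid
  valid-target (single _) = valid
  valid-target (pair₁ _ _) = valid
  valid-target (pair₂ _ _) = valid
  valid-target (pairᵒ _ _ _) = valid
  valid-target (pairᵉ _ _ _) = valid
  valid-target (appended _ _ _ _ _ _ _ _ _) = valid
  valid-target (spread _ _ _ _ _ _) = valid

  no-other : ∀ {x} → ¬ Other x
  no-other {x} ((≢0 , ≢1) , _) with x % 2 | m%n<n x 2
  ... | 0 | _ = ≢0 refl
  ... | 1 | _ = ≢1 refl
  ... | suc (suc _) | s≤s (s≤s ())

  target-index-injective : ∀ (i j : ∃ Index) → target (proj₂ i) ≡ target (proj₂ j) → source (proj₂ i) ≡ source (proj₂ j)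
  target-index-injective (k , p) (k′ , p′) eq
    with refl ← trans (sym (kind-target p)) (trans (cong kind eq) (kind-target p′)) = target-injective p p′ eq

  unhit : ∀ P → kind P ≡ none → ∀ (i : ∃ Index) → target (proj₂ i) ≢ P
  unhit P none! (k , p) eq with trans (sym (kind-target p)) (trans (cong kind eq) none!)
  unhit P none! (none , ()) eq | refl

  theorem : ∀ n → 11 ≤ n → q 1 0 2 n < q 0 1 2 n
  theorem n 11≤n = witness (parity n)
    where
    cover : ∀ P → Valid P → weight P ≡ n → length (Profile.α P) < length (Profile.β P) →
      ∃ λ (i : ∃ Index) → source (proj₂ i) ≡ P × Valid (target (proj₂ i)) × weight (target (proj₂ i)) ≡ n ×
              length (Profile.β (target (proj₂ i))) < length (Profile.α (target (proj₂ i)))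
    cover (profile α β _ _ (x ∷ Γ)) (_ , _ , x-other ∷ _ , _) _ _ = contradiction x-other no-other
    cover (profile α β _ _ []) (inj₁ (s≤s (s≤s ())) , _) _ _
    cover (profile α β _ _ []) (inj₂ refl , inj₁ (s≤s (s≤s ())) , _) _ _
    cover (profile α β 0 0 []) (inj₂ refl , inj₂ refl , _) refl bias
      with k , p , eq ← source-surjective α β bias 11≤n =
      (k , p) , eq , valid-target p , trans (weight-target p) (cong weight eq) , target-biased p

    conclude : ∀ W → Valid W → weight W ≡ n → length (Profile.β W) < length (Profile.α W) → kind W ≡ none → q 1 0 2 n < q 0 1 2 n
    conclude W W-ok W-weight W-bias none! =
      biased-<-by-injection (source ∘ proj₂) (target ∘ proj₂) target-index-injective cover W W-ok W-weight W-bias (unhit W none!)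

    witness : (∃ λ k → n ≡ k * 2 ⊎ n ≡ suc (k * 2)) → q 1 0 2 n < q 0 1 2 n
    witness (zero , inj₁ eq) = contradiction (subst (11 ≤_) eq 11≤n) λ ()
    -- For even `n`: the partition with `n` as its only part.
    witness (suc e , inj₁ eq) = conclude (profile [ e ] [] 0 0 []) valid (trans (rearrange e) (sym eq)) (s≤s z≤n) refl
      where
      rearrange : ∀ e → (suc (e + 0) + 0) * 2 + 0 ≡ suc e * 2
      rearrange = solve-∀
    -- For odd `n`: two parts 4 and one odd part, which is at least 3 because `n` is at least 11.
    witness (k , inj₂ eq) with k ∸ 5 | m+[n∸m]≡n {5} {k} (*-cancelʳ-≤ 5 k 2 (≤-pred (subst (11 ≤_) eq 11≤n)))
    ... | l | refl = conclude (profile (0 ∷ 1 ∷ []) [ l ] 0 0 []) valid (trans (rearrange l) (sym eq)) (s≤s (s≤s z≤n)) refl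
      where
      rearrange : ∀ l → 8 + ((suc (l + 0) + 0) * 2 + 1 + 0) ≡ suc ((5 + l) * 2)
      rearrange = solve-∀

-- The cases common to all m ≥ 3

-- The larger class of parts is encoded by the gaps h ∷ t and the smaller one by s; in the source
-- of the injection the larger class is the class of 1, in the target it is the class of 0.
record Shape : Set where
  no-eta-equality
  pattern
  constructor shape
  field
    h : ℕ
    t s : List ℕ
    u v : ℕ
    Γ : List ℕ

-- The parts added in an exchange with excess d = 2 + e: as many 2s as possible, and one 3 if d is
-- odd.
twos threes : ℕ → ℕ
twos 0 = 1
twos 1 = 0
twos (suc (suc e)) = suc (twos e)
threes 0 = 0
threes 1 = 1
threes (suc (suc e)) = threes e

twos-threes : ∀ e → twos e * 2 + threes e * 3 ≡ 2 + e
twos-threes 0 = refl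
twos-threes 1 = refl
twos-threes (suc (suc e)) = cong (suc ∘ suc) (twos-threes e)

-- Without a 3 the excess 3 + n is even, hence at least 4.
threes-zero⇒2≤twos : ∀ n → threes (suc n) ≡ 0 → 2 ≤ twos (suc n)
threes-zero⇒2≤twos 1 _ = ≤-refl
threes-zero⇒2≤twos (suc (suc n)) eq = m≤n⇒m≤1+n (threes-zero⇒2≤twos n eq)

remainder-3 : ∀ n → ∃ λ i → n ≡ i * 3 ⊎ n ≡ 1 + i * 3 ⊎ n ≡ 2 + i * 3
remainder-3 0 = 0 , inj₁ refl
remainder-3 (suc n) with remainder-3 n
... | i , inj₁ refl = i , inj₂ (inj₁ refl)
... | i , inj₂ (inj₁ refl) = i , inj₂ (inj₂ refl)
... | i , inj₂ (inj₂ refl) = suc i , inj₁ refl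

-- For an excess d = 2 + e with threes e = b, these numbers of twos and threes (of sum 2 + 6 j) do
-- not contain twos e twos and threes e threes, so they do not arise from an exchange with excess d.
someTwos someThrees : ℕ → ℕ → ℕ
someTwos zero j = 1
someTwos (suc _) j = 1 + j * 3
someThrees zero j = j * 2
someThrees (suc _) j = 0

some-sum : ∀ b j → someTwos b j * 2 + someThrees b j * 3 ≡ 2 + j * 3 * 2
some-sum zero j = rearrange j
  where
  rearrange : ∀ j → 2 + j * 2 * 3 ≡ 2 + j * 3 * 2
  rearrange = solve-∀
some-sum (suc b) j = rearrange j
  where
  rearrange : ∀ j → (1 + j * 3) * 2 + 0 ≡ 2 + j * 3 * 2
  rearrange = solve-∀

some-injective : ∀ b {j j′} → someTwos b j ≡ someTwos b j′ → someThrees b j ≡ someThrees b j′ → j ≡ j′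
some-injective zero {j} {j′} _ eq = *-cancelʳ-≡ j j′ 2 eq
some-injective (suc b) {j} {j′} eq _ = *-cancelʳ-≡ j j′ 3 (suc-injective eq)

data Kind : Set where
  swapped three one two removed extra : Kind

-- Replacing a 3 by 2 + 2 leaves at least two parts 2. With fewer of them, an odd number of 3s comes
-- from `one` or `two`, which leaves the even numbers free for the extra cases.
kind-equal : ℕ → ℕ → Kind
kind-equal 0 v = if isEven v then extra else one
kind-equal 1 v = if isEven v then extra else two
kind-equal (suc (suc _)) _ = three

-- Every image of `removed` contains a part 2; the extra images with excess at least 2 contain none.
kind-unswapped : ℕ → Kind
kind-unswapped zero = extra
kind-unswapped (suc _) = removed

-- The largest zero is not counted in the first argument, so `suc e` stands for excess 2 + e.
-- Whenever the 2s and 3s added by an exchange can be taken away again, the image is read as that of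
-- an exchange.
kind-excess : ℕ → ℕ → ℕ → Kind
kind-excess zero u v = kind-equal u v
kind-excess (suc e) u v = if (twos e <ᵇ suc u) ∧ (threes e <ᵇ suc v) then swapped else kind-unswapped u

kind : Shape → Kind
kind (shape h t s u v Γ) = kind-excess (length t ∸ length s) u v

module Shapes (m : ℕ) where

  rest : Shape → ℕ
  rest (shape h t s u v Γ) = u * 2 + (v * 3 + sum Γ)

  sourceWeight targetWeight : Shape → ℕ
  sourceWeight S@(shape h t s u v Γ) = energy s * m + (energy (h ∷ t) * m + suc (length t) + rest S)
  targetWeight S@(shape h t s u v Γ) = energy (h ∷ t) * m + (energy s * m + length s + rest S)

  -- Only the sources with a single one, no zeros, no 3 and a multiple of three 2s need a treatment
  -- depending on `m`; they are supplied as `X`.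
  module Extension
    (X : Set) (sourceˣ targetˣ : X → Shape)
    (kindˣ : ∀ x → kind (targetˣ x) ≡ extra)
    (injectiveˣ : ∀ x y → targetˣ x ≡ targetˣ y → sourceˣ x ≡ sourceˣ y)
    where

    data Index : Kind → Set where
      swapped : ∀ (e h : ℕ) (t s : List ℕ) (u v : ℕ) (Γ : List ℕ) → length t ≡ length s + suc e → Index swapped
      three   : ∀ (h : ℕ) (t s : List ℕ) (u v : ℕ) (Γ : List ℕ) → length t ≡ length s → Index three
      one     : ∀ (h : ℕ) (t s : List ℕ) (i : ℕ) (Γ : List ℕ) → length t ≡ length s → Index one
      two     : ∀ (h : ℕ) (t s : List ℕ) (i : ℕ) (Γ : List ℕ) → length t ≡ length s → Index two
      removed : ∀ (h : ℕ) (t : List ℕ) (i : ℕ) (s : List ℕ) (j : ℕ) (Γ : List ℕ) → length t ≡ suc (length s) → Index removed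
      extra   : X → Index extra

    source target : ∀ {k} → Index k → Shape
    source (swapped e h t s u v Γ _) = shape h t s u v Γ
    source (three h t s u v Γ _) = shape h t s u (suc v) Γ
    source (one h t s i Γ _) = shape h t s (1 + i * 3) 0 Γ
    source (two h t s i Γ _) = shape h t s (2 + i * 3) 0 Γ
    source (removed h t i s j Γ _) = shape h t (s ++ [ i ]) (j * 3) 0 Γ
    source (extra x) = sourceˣ x
    target (swapped e h t s u v Γ _) = shape h t s (u + twos e) (v + threes e) Γ
    target (three h t s u v Γ _) = shape h t s (2 + u) v Γ
    target (one h t s i Γ _) = shape h t s 0 (suc (i * 2)) Γ
    target (two h t s i Γ _) = shape h t s 1 (suc (i * 2)) Γ
    target (removed h t i s j Γ _) =
      -- With a = `suc (length s)` zeros, `suc n` = 1 + i a units of `m` are set free. The image has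
      -- excess 3 + n, so its 2s and 3s have to avoid those of an exchange with parameter `suc n`.
      let n = i * suc (length s) in
      shape h (t ++ replicate (suc n) 0) s (someTwos (threes (suc n)) j) (someThrees (threes (suc n)) j) Γ
    target (extra x) = targetˣ x

    -- If the exchange adds no 3, it adds at least two 2s, but only one is present; if it adds a 3,
    -- none is present.
    kind-some : ∀ n j → kind-excess (suc (suc n)) (someTwos (threes (suc n)) j) (someThrees (threes (suc n)) j) ≡ removed
    kind-some n j with threes (suc n) in eq
    ... | zero rewrite <ᵇ-false {twos (suc n)} {2} (threes-zero⇒2≤twos n eq) = refl
    ... | suc b rewrite ∧-zeroʳ (twos (suc n) <ᵇ suc (suc (j * 3))) = refl

    kind-target : ∀ {k} (p : Index k) → kind (target p) ≡ k
    kind-target (swapped e h t s u v Γ len)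
      rewrite len | m+n∸m≡n (length s) (suc e) | <ᵇ-true (s≤s (m≤n+m (twos e) u)) | <ᵇ-true (s≤s (m≤n+m (threes e) v)) = refl
    kind-target (three h t s u v Γ len) rewrite len | n∸n≡0 (length s) = refl
    kind-target (one h t s i Γ len) rewrite len | n∸n≡0 (length s) | isEven-odd i = refl
    kind-target (two h t s i Γ len) rewrite len | n∸n≡0 (length s) | isEven-odd i = refl
    kind-target (removed h t i s j Γ len)
      rewrite length-++-zeros t (suc (i * suc (length s))) | len
            | sym (+-suc (length s) (suc (i * suc (length s)))) | m+n∸m≡n (length s) (suc (suc (i * suc (length s)))) = kind-some (i * suc (length s)) j
    kind-target (extra x) = kindˣ x

    shape-injective : ∀ {h h′ t t′ s s′ u u′ v v′ Γ Γ′} → shape h t s u v Γ ≡ shape h′ t′ s′ u′ v′ Γ′ →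
      h ≡ h′ × t ≡ t′ × s ≡ s′ × u ≡ u′ × v ≡ v′ × Γ ≡ Γ′
    shape-injective refl = refl , refl , refl , refl , refl , refl

    target-injective-same : ∀ {k} (p p′ : Index k) → target p ≡ target p′ → source p ≡ source p′
    target-injective-same (swapped e h t s u v Γ len) (swapped e′ h′ t′ s′ u′ v′ Γ′ len′) eq
      with refl , refl , refl , equ , eqv , refl ← shape-injective eq
      with refl ← suc-injective (+-cancelˡ-≡ (length s) _ _ (trans (sym len) len′))
      with refl ← +-cancelʳ-≡ (twos e) u u′ equ
      with refl ← +-cancelʳ-≡ (threes e) v v′ eqv = refl
    target-injective-same (three h t s u v Γ len) (three .h .t .s .u .v .Γ len′) refl = refl
    target-injective-same (one h t s i Γ len) (one h′ t′ s′ i′ Γ′ len′) eq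
      with refl , refl , refl , _ , eqv , refl ← shape-injective eq
      with refl ← *-cancelʳ-≡ i i′ 2 (suc-injective eqv) = refl
    target-injective-same (two h t s i Γ len) (two h′ t′ s′ i′ Γ′ len′) eq
      with refl , refl , refl , _ , eqv , refl ← shape-injective eq
      with refl ← *-cancelʳ-≡ i i′ 2 (suc-injective eqv) = refl
    target-injective-same (removed h t i s j Γ len) (removed h′ t′ i′ s′ j′ Γ′ len′) eq
      with refl , eqt , refl , equ , eqv , refl ← shape-injective eq
      with refl , eqz ← ++-injective {t} {t′} (trans len (sym len′)) eqt
      with refl ← *-cancelʳ-≡ i i′ (suc (length s)) (suc-injective (replicate-injective {x = 0} eqz))
      -- With `i` and `s` known, both sides use the same choice of 2s and 3s, so `j` can be read
      -- off.
      with refl ← some-injective (threes (suc (i * suc (length s)))) equ eqv = refl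
    target-injective-same (extra x) (extra y) eq = injectiveˣ x y eq

    target-injective : ∀ (i j : ∃ Index) → target (proj₂ i) ≡ target (proj₂ j) → source (proj₂ i) ≡ source (proj₂ j)
    target-injective (k , p) (k′ , p′) eq
      with refl ← trans (sym (kind-target p)) (trans (cong kind eq) (kind-target p′)) = target-injective-same p p′ eq

    module _ (weightˣ : ∀ x → targetWeight (targetˣ x) ≡ sourceWeight (sourceˣ x)) where

      targetWeight-target : ∀ {k} (p : Index k) → targetWeight (target p) ≡ sourceWeight (source p)
      targetWeight-target (swapped e h t s u v Γ len) rewrite len =
        trans (rearrange₁ m (energy (h ∷ t)) (energy s) (length s) u v (twos e) (threes e) (sum Γ))
          (trans (cong (λ d → energy (h ∷ t) * m + (energy s * m + length s + (u * 2 + (v * 3 + sum Γ)) + d)) (twos-threes e))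
                 (rearrange₂ m (energy (h ∷ t)) (energy s) (length s) e (u * 2 + (v * 3 + sum Γ))))
        where
        rearrange₁ : ∀ m Et Es ls u v U V G → Et * m + (Es * m + ls + ((u + U) * 2 + ((v + V) * 3 + G)))
          ≡ Et * m + (Es * m + ls + (u * 2 + (v * 3 + G)) + (U * 2 + V * 3))
        rearrange₁ = solve-∀
        rearrange₂ : ∀ m Et Es ls e R → Et * m + (Es * m + ls + R + (2 + e)) ≡ Es * m + (Et * m + suc (ls + suc e) + R)
        rearrange₂ = solve-∀
      targetWeight-target (three h t s u v Γ len) rewrite len =
        rearrange m (energy (h ∷ t)) (energy s) (length s) u v (sum Γ)
        where
        rearrange : ∀ m Et Es ls u v G → Et * m + (Es * m + ls + ((2 + u) * 2 + (v * 3 + G)))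
          ≡ Es * m + (Et * m + suc ls + (u * 2 + (suc v * 3 + G)))
        rearrange = solve-∀
      targetWeight-target (one h t s i Γ len) rewrite len =
        rearrange m (energy (h ∷ t)) (energy s) (length s) i (sum Γ)
        where
        rearrange : ∀ m Et Es ls i G → Et * m + (Es * m + ls + (suc (i * 2) * 3 + G))
          ≡ Es * m + (Et * m + suc ls + ((1 + i * 3) * 2 + G))
        rearrange = solve-∀
      targetWeight-target (two h t s i Γ len) rewrite len =
        rearrange m (energy (h ∷ t)) (energy s) (length s) i (sum Γ)
        where
        rearrange : ∀ m Et Es ls i G → Et * m + (Es * m + ls + (2 + (suc (i * 2) * 3 + G)))
          ≡ Es * m + (Et * m + suc ls + ((2 + i * 3) * 2 + G))
        rearrange = solve-∀
      targetWeight-target (removed h t i s j Γ len)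
        rewrite energy-++-zeros t (suc (i * suc (length s))) | sum-++-zeros t (suc (i * suc (length s))) | energy-∷ʳ s i | len =
        trans (rearrange₁ m h (sum t) (energy t) i (energy s) (length s) (someTwos b j) (someThrees b j) (sum Γ))
          (trans (cong (λ d → (suc (h + sum t) + (energy t + suc (i * suc (length s)))) * m + (energy s * m + length s + (d + sum Γ))) (some-sum b j))
                 (rearrange₂ m h (sum t) (energy t) i (energy s) (length s) j (sum Γ)))
        where
        b : ℕ
        b = threes (suc (i * suc (length s)))
        rearrange₁ : ∀ m h St Et i Es ls U V G →
          (suc (h + St) + (Et + suc (i * suc ls))) * m + (Es * m + ls + (U * 2 + (V * 3 + G)))
          ≡ (suc (h + St) + (Et + suc (i * suc ls))) * m + (Es * m + ls + (U * 2 + V * 3 + G))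
        rearrange₁ = solve-∀
        rearrange₂ : ∀ m h St Et i Es ls j G →
          (suc (h + St) + (Et + suc (i * suc ls))) * m + (Es * m + ls + (2 + j * 3 * 2 + G))
          ≡ (Es + suc (i + ls * i)) * m + ((suc (h + St) + Et) * m + suc (suc ls) + (j * 3 * 2 + G))
        rearrange₂ = solve-∀
      targetWeight-target (extra x) = weightˣ x

    module _ (biasˣ : ∀ x → length (Shape.s (targetˣ x)) ≤ length (Shape.t (targetˣ x))) where

      target-biased : ∀ {k} (p : Index k) → length (Shape.s (target p)) ≤ length (Shape.t (target p))
      target-biased (swapped e h t s u v Γ len) rewrite len = m≤m+n _ _
      target-biased (three h t s u v Γ len) = ≤-reflexive (sym len)
      target-biased (one h t s i Γ len) = ≤-reflexive (sym len)
      target-biased (two h t s i Γ len) = ≤-reflexive (sym len)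
      target-biased (removed h t i s j Γ len) rewrite length-++-zeros t (suc (i * suc (length s))) | len = ≤-trans (n≤1+n _) (m≤m+n _ _)
      target-biased (extra x) = biasˣ x

    module _ (Admissible : ℕ → List ℕ → Set)
      (coverˣ : ∀ h j Γ → Admissible h Γ → 4 * m + 3 ≤ sourceWeight (shape h [] [] (j * 3) 0 Γ) →
        ∃ λ x → sourceˣ x ≡ shape h [] [] (j * 3) 0 Γ × Admissible (Shape.h (targetˣ x)) (Shape.Γ (targetˣ x)))
      where

      source-surjective : ∀ h t s u v Γ → length s ≤ length t → Admissible h Γ → 4 * m + 3 ≤ sourceWeight (shape h t s u v Γ) →
        ∃₂ λ k (p : Index k) → source p ≡ shape h t s u v Γ × Admissible (Shape.h (target p)) (Shape.Γ (target p))
      source-surjective h t s u v Γ s≤t ok big with length t ∸ length s | m+[n∸m]≡n s≤t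
      ... | suc e | len = _ , swapped e h t s u v Γ (sym len) , refl , ok
      ... | zero | len = equal v (trans (sym len) (+-identityʳ _)) big
        where
        equal : ∀ v → length t ≡ length s → 4 * m + 3 ≤ sourceWeight (shape h t s u v Γ) →
          ∃₂ λ k (p : Index k) → source p ≡ shape h t s u v Γ × Admissible (Shape.h (target p)) (Shape.Γ (target p))
        equal (suc v) len _ = _ , three h t s u v Γ len , refl , ok
        equal zero len big with remainder-3 u
        ... | i , inj₂ (inj₁ refl) = _ , one h t s i Γ len , refl , ok
        ... | i , inj₂ (inj₂ refl) = _ , two h t s i Γ len , refl , ok
        ... | i , inj₁ refl = last-case t s len big
          where
          last-case : ∀ t s → length t ≡ length s → 4 * m + 3 ≤ sourceWeight (shape h t s (i * 3) 0 Γ) →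
            ∃₂ λ k (p : Index k) → source p ≡ shape h t s (i * 3) 0 Γ × Admissible (Shape.h (target p)) (Shape.Γ (target p))
          last-case t s len big with initLast s
          ... | s′ ∷ʳ′ k = _ , removed h t k s′ i Γ (trans len (length-∷ʳ s′ k)) , refl , ok
          last-case [] _ len big | []
            with x , eq , ok′ ← coverˣ h i Γ ok big = _ , extra x , eq , ok′

-- Transfer from shapes to partitions

module Transfer (m : ℕ) .{{_ : NonZero m}} (2≤m : 2 ≤ m) where

  open Profiles m 2≤m
  open Shapes m

  -- The translations of shapes into profiles are parameters because `m` = 3 reads `v` differently.
  -- Admissibility travels with each index, so injectivity is required on admissible shapes only. As
  -- `W` has kind `extra`, only the extra targets have to be compared with it.
  biased-<-by-extension : (n : ℕ) → 4 * m + 3 ≤ n →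
    (Admissible : ℕ → List ℕ → Set) (toSource toTarget : Shape → Profile) →
    let Ok = λ S → Admissible (Shape.h S) (Shape.Γ S) in
    (∀ {S S′} → Ok S → Ok S′ → toTarget S ≡ toTarget S′ → S ≡ S′) →
    (∀ S → Ok S → Valid (toTarget S) × weight (toTarget S) ≡ targetWeight S) →
    (∀ S → length (Shape.s S) ≤ length (Shape.t S) → length (Profile.β (toTarget S)) < length (Profile.α (toTarget S))) →
    (∀ P → Valid P → length (Profile.α P) < length (Profile.β P) →
      ∃ λ S → toSource S ≡ P × Ok S × weight P ≡ sourceWeight S × length (Shape.s S) ≤ length (Shape.t S)) →
    (X : Set) (sourceˣ targetˣ : X → Shape) →
    (∀ x → kind (targetˣ x) ≡ extra) →
    (∀ x y → targetˣ x ≡ targetˣ y → sourceˣ x ≡ sourceˣ y) →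
    (∀ x → targetWeight (targetˣ x) ≡ sourceWeight (sourceˣ x)) →
    (∀ x → length (Shape.s (targetˣ x)) ≤ length (Shape.t (targetˣ x))) →
    (∀ h j Γ → Admissible h Γ → 4 * m + 3 ≤ sourceWeight (shape h [] [] (j * 3) 0 Γ) →
        ∃ λ x → sourceˣ x ≡ shape h [] [] (j * 3) 0 Γ × Ok (targetˣ x)) →
    ∀ W → Ok W → kind W ≡ extra → targetWeight W ≡ n → length (Shape.s W) ≤ length (Shape.t W) → (∀ x → targetˣ x ≢ W) →
    q 1 0 m n < q 0 1 m n
  biased-<-by-extension n big Admissible toSource toTarget toTarget-injective target-ok target-bias decompose
      X sourceˣ targetˣ kindˣ injectiveˣ weightˣ biasˣ coverˣ W W-ok W-kind W-weight W-bias missed =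
    biased-<-by-injection {I = I} (λ (i , _) → toSource (source (proj₂ i))) (λ (i , _) → toTarget (target (proj₂ i)))
      (λ (i , ok) (j , ok′) eq → cong toSource (target-injective i j (toTarget-injective ok ok′ eq)))
      cover (toTarget W) (proj₁ (target-ok W W-ok)) (trans (proj₂ (target-ok W W-ok)) W-weight) (target-bias W W-bias) avoided
    where
    open Extension X sourceˣ targetˣ kindˣ injectiveˣ
    Ok : Shape → Set
    Ok S = Admissible (Shape.h S) (Shape.Γ S)
    I : Set
    I = ∃ λ (i : ∃ Index) → Ok (target (proj₂ i))
    cover : ∀ P → Valid P → weight P ≡ n → length (Profile.α P) < length (Profile.β P) →
      ∃ λ (i : I) → toSource (source (proj₂ (proj₁ i))) ≡ P × Valid (toTarget (target (proj₂ (proj₁ i)))) ×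
        weight (toTarget (target (proj₂ (proj₁ i)))) ≡ n ×
        length (Profile.β (toTarget (target (proj₂ (proj₁ i))))) < length (Profile.α (toTarget (target (proj₂ (proj₁ i)))))
    cover P P-ok refl bias
      with shape h t s u v Γ , refl , ok , weight≡ , s≤t ← decompose P P-ok bias
      with k , p , eq , ok′ ← source-surjective Admissible coverˣ h t s u v Γ s≤t ok (subst (4 * m + 3 ≤_) weight≡ big) =
      ((k , p) , ok′) , cong toSource eq , proj₁ (target-ok (target p) ok′) ,
      trans (proj₂ (target-ok (target p) ok′))
        (trans (targetWeight-target weightˣ p) (trans (cong sourceWeight eq) (sym weight≡))) ,
      target-bias (target p) (target-biased biasˣ p)
    avoid-same : ∀ {k} (p : Index k) → k ≡ extra → target p ≢ W
    avoid-same (extra x) refl = missed x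
    avoided : ∀ (i : I) → toTarget (target (proj₂ (proj₁ i))) ≢ toTarget W
    avoided ((k , p) , ok) eq with toTarget-injective ok W-ok eq
    ... | target≡W = avoid-same p (trans (sym (kind-target p)) (trans (cong kind target≡W) W-kind)) target≡W

-- Consequences of n ≥ 4 m + 3

module _ (m : ℕ) .{{_ : NonZero m}} where

  -- If the remainder is below 3, the bound leaves a fifth multiple of `m` to be spent on the missed
  -- partition.
  quotient-remainder : ∀ n → 4 * m + 3 ≤ n → ∃₂ λ k r → n ≡ r + (4 + k) * m × r < m × (3 ≤ r ⊎ 1 ≤ k)
  quotient-remainder n big = n / m ∸ 4 , n % m , n≡ , m%n<n n m , enough (n / m ∸ 4) n≡
    where
    4≤n/m : 4 ≤ n / m
    4≤n/m = ≤-trans (≤-reflexive (sym (m*n/n≡m 4 m))) (/-monoˡ-≤ m (≤-trans (m≤m+n (4 * m) 3) big))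
    n≡ : n ≡ n % m + (4 + (n / m ∸ 4)) * m
    n≡ = trans (m≡m%n+[m/n]*n n m) (cong (λ k → n % m + k * m) (sym (m+[n∸m]≡n 4≤n/m)))
    enough : ∀ k → n ≡ n % m + (4 + k) * m → 3 ≤ n % m ⊎ 1 ≤ k
    enough (suc k) _ = inj₂ (s≤s z≤n)
    enough zero eq = inj₁ (+-cancelˡ-≤ (4 * m) 3 (n % m) (≤-trans big (≤-reflexive (trans eq (+-comm (n % m) (4 * m))))))

-- The weight is that of a part m + 1 and `j * 3` parts 2. Of the `j * 2` threes into which the 2s
-- combine, `m` can then be traded for three new parts `m`.
m≤2j : ∀ m j → 4 * m + 3 ≤ 1 * m + 1 + (j * 3 * 2 + 0) → m ≤ j * 2
m≤2j m j big = *-cancelʳ-≤ m (j * 2) 3 (+-cancelˡ-≤ (1 * m + 1) _ _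
  (≤-trans (≤-reflexive (rearrange₁ m)) (≤-trans (m≤m+n (4 * m + 1) 2) (≤-trans (≤-reflexive (rearrange₂ m)) (≤-trans big (≤-reflexive (rearrange₃ m j)))))))
  where
  rearrange₁ : ∀ m → 1 * m + 1 + m * 3 ≡ 4 * m + 1
  rearrange₁ = solve-∀
  rearrange₂ : ∀ m → 4 * m + 1 + 2 ≡ 4 * m + 3
  rearrange₂ = solve-∀
  rearrange₃ : ∀ m j → 1 * m + 1 + (j * 3 * 2 + 0) ≡ 1 * m + 1 + j * 2 * 3
  rearrange₃ = solve-∀

-- The case m = 3

module ModulusThree where

  open Profiles 3 (s≤s (s≤s z≤n))
  open Shapes 3
  open Transfer 3 (s≤s (s≤s z≤n))

  -- The single one is a part 4. If there is a further part, the largest is `2 + j * 3`; `absorb`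
  -- joins it with the 4 and all the 2s into two multiples of 3. Otherwise `alone` keeps the 4 and
  -- turns the 2s into three multiples of 3.
  data X : Set where
    alone : ∀ j v → j * 2 ≡ 3 + v → X
    absorb : ∀ (i j : ℕ) (Γ : List ℕ) → X

  sourceˣ targetˣ : X → Shape
  sourceˣ (alone j v _) = shape 0 [] [] (j * 3) 0 []
  sourceˣ (absorb i j Γ) = shape 0 [] [] (i * 3) 0 ((2 + j * 3) ∷ Γ)
  targetˣ (alone j v _) = shape 0 (0 ∷ 0 ∷ []) [ 0 ] 0 v []
  targetˣ (absorb i j Γ) = shape 0 [ i ] [] 0 j Γ

  kindˣ : ∀ x → kind (targetˣ x) ≡ extra
  kindˣ (alone j v _) = refl
  kindˣ (absorb i j Γ) = refl

  injectiveˣ : ∀ x y → targetˣ x ≡ targetˣ y → sourceˣ x ≡ sourceˣ y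
  injectiveˣ (alone j v eq) (alone j′ .v eq′) refl = cong (λ j → shape 0 [] [] (j * 3) 0 []) (*-cancelʳ-≡ j j′ 2 (trans eq (sym eq′)))
  injectiveˣ (absorb i j Γ) (absorb .i .j .Γ) refl = refl

  weightˣ : ∀ x → targetWeight (targetˣ x) ≡ sourceWeight (sourceˣ x)
  weightˣ (alone j v eq) = trans (rearrange₁ v) (trans (cong (λ d → 4 + d * 3) (sym eq)) (rearrange₂ j))
    where
    rearrange₁ : ∀ v → 13 + (v * 3 + 0) ≡ 4 + (3 + v) * 3
    rearrange₁ = solve-∀
    rearrange₂ : ∀ j → 4 + j * 2 * 3 ≡ 4 + (j * 3 * 2 + 0)
    rearrange₂ = solve-∀
  weightˣ (absorb i j Γ) = rearrange i j (sum Γ)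
    where
    rearrange : ∀ i j G → (suc (i + 0) + (suc (i + 0) + 0)) * 3 + (j * 3 + G) ≡ 4 + (i * 3 * 2 + (2 + j * 3 + G))
    rearrange = solve-∀

  biasˣ : ∀ x → length (Shape.s (targetˣ x)) ≤ length (Shape.t (targetˣ x))
  biasˣ (alone j v _) = s≤s z≤n
  biasˣ (absorb i j Γ) = z≤n

  -- For m = 3 the number v stands for the largest gap, and h is not used.
  Admissible : ℕ → List ℕ → Set
  Admissible h Γ = h ≡ 0 × All Other Γ × Descending Γ

  toSource toTarget : Shape → Profile
  toSource (shape h t s u v Γ) = profile s (v ∷ t) u 0 Γ
  toTarget (shape h t s u v Γ) = profile (v ∷ t) s u 0 Γ

  other-3 : ∀ {g} → Other g → g ≡ 2 + g / 3 * 3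
  other-3 {g} ((≢0 , ≢1) , _) with g % 3 | m≡m%n+[m/n]*n g 3 | m%n<n g 3
  ... | 0 | _ | _ = contradiction refl ≢0
  ... | 1 | _ | _ = contradiction refl ≢1
  ... | 2 | eq | _ = eq
  ... | suc (suc (suc _)) | _ | s≤s (s≤s (s≤s ()))

  coverˣ : ∀ h j Γ → Admissible h Γ → 15 ≤ sourceWeight (shape h [] [] (j * 3) 0 Γ) →
    ∃ λ x → sourceˣ x ≡ shape h [] [] (j * 3) 0 Γ × Admissible (Shape.h (targetˣ x)) (Shape.Γ (targetˣ x))
  coverˣ _ j [] (refl , _) big = alone j (j * 2 ∸ 3) (sym (m+[n∸m]≡n (m≤2j 3 j big))) , refl , refl , [] , []
  coverˣ _ j (g ∷ Γ) (refl , g-other ∷ others , _ ∷ desc) _ =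
    absorb j (g / 3) Γ , cong (λ g → shape 0 [] [] (j * 3) 0 (g ∷ Γ)) (sym (other-3 g-other)) , refl , others , desc

  toTarget-injective : ∀ {S S′} → Admissible (Shape.h S) (Shape.Γ S) → Admissible (Shape.h S′) (Shape.Γ S′) → toTarget S ≡ toTarget S′ → S ≡ S′
  toTarget-injective {shape _ t s u v Γ} {shape _ .t .s .u .v .Γ} (refl , _) (refl , _) refl = refl

  -- For `m` = 3, adding `v` to the first gap weighs as much as `v` parts 3.
  gap-weight : ∀ R x ls lb u v G → (suc (v + x) + R) * 3 + (ls * 3 + lb + (u * 2 + (0 + G))) ≡ (suc x + R) * 3 + (ls * 3 + lb + (u * 2 + (v * 3 + G)))
  gap-weight = solve-∀

  gap-weight′ : ∀ R x ls lb u v G → ls * 3 + ((suc (v + x) + R) * 3 + lb + (u * 2 + (0 + G))) ≡ ls * 3 + ((suc x + R) * 3 + lb + (u * 2 + (v * 3 + G)))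
  gap-weight′ = solve-∀

  target-ok : ∀ S → Admissible (Shape.h S) (Shape.Γ S) → Valid (toTarget S) × weight (toTarget S) ≡ targetWeight S
  target-ok (shape _ t s u v Γ) (refl , others , desc) =
    (inj₁ ≤-refl , inj₂ refl , others , desc) , gap-weight (energy t) (sum t) (energy s) (length s) u v (sum Γ)

  decompose : ∀ P → Valid P → length (Profile.α P) < length (Profile.β P) →
    ∃ λ S → toSource S ≡ P × Admissible (Shape.h S) (Shape.Γ S) × weight P ≡ sourceWeight S × length (Shape.s S) ≤ length (Shape.t S)
  decompose (profile s (v ∷ t) u _ Γ) (_ , inj₁ (s≤s (s≤s (s≤s ()))) , _) _
  decompose (profile s (v ∷ t) u _ Γ) (_ , inj₂ refl , others , desc) (s≤s bias) =
    shape 0 t s u v Γ , refl , (refl , others , desc) , gap-weight′ (energy t) (sum t) (energy s) (suc (length t)) u v (sum Γ) , bias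

  theorem : ∀ n → 15 ≤ n → q 1 0 3 n < q 0 1 3 n
  theorem n big = witness (quotient-remainder 3 n big)
    where
    conclude : ∀ W → Admissible (Shape.h W) (Shape.Γ W) → kind W ≡ extra → targetWeight W ≡ n →
      length (Shape.s W) ≤ length (Shape.t W) → (∀ x → targetˣ x ≢ W) → q 1 0 3 n < q 0 1 3 n
    conclude = biased-<-by-extension n big Admissible toSource toTarget toTarget-injective target-ok (λ { (shape _ _ _ _ _ _) → s≤s }) decompose
      X sourceˣ targetˣ kindˣ injectiveˣ weightˣ biasˣ coverˣ

    witness : (∃₂ λ k r → n ≡ r + (4 + k) * 3 × r < 3 × (3 ≤ r ⊎ 1 ≤ k)) → q 1 0 3 n < q 0 1 3 n
    -- Four zeros and no part 2: an exchange with excess 4 would have added two 2s, and no extra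
    -- target has three gaps in `t`.
    witness (k , 0 , n≡ , _) = conclude (shape 0 (0 ∷ 0 ∷ 0 ∷ []) [] 0 k []) (refl , [] , []) refl
      (trans (rearrange k) (sym n≡)) z≤n λ { (alone _ _ _) () ; (absorb _ _ _) () }
      where
      rearrange : ∀ k → 12 + (k * 3 + 0) ≡ (4 + k) * 3
      rearrange = solve-∀
    -- The one is a 7 here, while it is a 4 in the targets of `alone`.
    witness (suc k , 1 , n≡ , _) = conclude (shape 0 (0 ∷ 0 ∷ []) [ 1 ] 0 k []) (refl , [] , []) refl
      (trans (rearrange k) (sym n≡)) (s≤s z≤n) λ { (alone _ _ _) () ; (absorb _ _ _) () }
      where
      rearrange : ∀ k → 16 + (k * 3 + 0) ≡ 1 + (5 + k) * 3
      rearrange = solve-∀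
    witness (suc k , 2 , n≡ , _) = conclude (shape 0 (0 ∷ 0 ∷ 0 ∷ []) [] 0 k [ 5 ])
      (refl , (((λ ()) , λ ()) , s≤s (s≤s (s≤s (s≤s z≤n)))) ∷ [] , [] ∷ []) refl
      (trans (rearrange k) (sym n≡)) z≤n λ { (alone _ _ _) () ; (absorb _ _ _) () }
      where
      rearrange : ∀ k → 12 + (k * 3 + 5) ≡ 2 + (5 + k) * 3
      rearrange = solve-∀
    witness (0 , 1 , _ , _ , inj₁ (s≤s ()))
    witness (0 , 2 , _ , _ , inj₁ (s≤s (s≤s ())))
    witness (_ , suc (suc (suc _)) , _ , s≤s (s≤s (s≤s ())) , _)

-- The case m ≥ 4

module ModulusLarge (m₁ : ℕ) (4≤m : 4 ≤ suc m₁) where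

  m : ℕ
  m = suc m₁

  2≤m : 2 ≤ m
  2≤m = ≤-trans (s≤s (s≤s z≤n)) 4≤m

  open Profiles m 2≤m
  open Shapes m
  open Transfer m 2≤m

  -- The single one is `(h + 1) * m + 1`. For `h` at least 2, `split` breaks off parts m and m + 1.
  -- Otherwise `raise` gives the 1 to the largest other part, or `absorb` joins the two into two
  -- zeros if that part is m - 1 modulo `m`. With no other part, `alone` trades 3s for zeros.
  -- `insert` breaks 2 m + 1 into m, m - 1 and 2. The number `v` of 3s is tied to `i` by an equation
  -- only, so that equality of targets can be matched with `refl`.
  data X : Set where
    split    : ∀ (k i v : ℕ) (Γ : List ℕ) → v ≡ i * 2 → X
    alone    : ∀ i v → i * 2 ≡ m + v → X
    raise    : ∀ (i v g : ℕ) (Γ : List ℕ) → v ≡ i * 2 → X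
    absorb   : ∀ (i v j : ℕ) (Γ : List ℕ) → v ≡ i * 2 → X
    insert   : ∀ (i v : ℕ) (Γ : List ℕ) → v ≡ i * 2 → X
    alone′   : ∀ i v → i * 2 ≡ m + v → X
    raise′   : ∀ (i v g : ℕ) (Γ : List ℕ) → v ≡ i * 2 → X
    absorb′  : ∀ (i v j : ℕ) (Γ : List ℕ) → v ≡ i * 2 → X

  sourceˣ targetˣ : X → Shape
  sourceˣ (split k i v Γ _) = shape (2 + k) [] [] (i * 3) 0 Γ
  sourceˣ (alone i v _) = shape 0 [] [] (i * 3) 0 []
  sourceˣ (raise i v g Γ _) = shape 0 [] [] (i * 3) 0 (g ∷ Γ)
  sourceˣ (absorb i v j Γ _) = shape 0 [] [] (i * 3) 0 ((m₁ + j * m) ∷ Γ)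
  sourceˣ (insert i v Γ _) = shape 1 [] [] (i * 3) 0 Γ
  sourceˣ (alone′ i v _) = shape 1 [] [] (i * 3) 0 []
  sourceˣ (raise′ i v g Γ _) = shape 1 [] [] (i * 3) 0 (g ∷ Γ)
  sourceˣ (absorb′ i v j Γ _) = shape 1 [] [] (i * 3) 0 ((m₁ + suc j * m) ∷ Γ)
  targetˣ (split k i v Γ _) = shape k [ 0 ] [ 0 ] 0 v Γ
  targetˣ (alone i v _) = shape 0 (0 ∷ 0 ∷ []) [ 0 ] 0 v []
  targetˣ (raise i v g Γ _) = shape 0 [] [] 0 v (suc g ∷ Γ)
  targetˣ (absorb i v j Γ _) = shape j [ 0 ] [] 0 v Γ
  targetˣ (insert i v Γ _) = shape 0 [] [] 1 v (m₁ ∷ Γ)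
  targetˣ (alone′ i v _) = shape 1 (0 ∷ 0 ∷ []) [ 0 ] 0 v []
  targetˣ (raise′ i v g Γ _) = shape 1 [] [] 0 v (suc g ∷ Γ)
  targetˣ (absorb′ i v j Γ _) = shape j [ 1 ] [] 0 v Γ

  kindˣ : ∀ x → kind (targetˣ x) ≡ extra
  kindˣ (split k i v Γ refl) rewrite isEven-even i = refl
  kindˣ (alone i v _) = refl
  kindˣ (raise i v g Γ refl) rewrite isEven-even i = refl
  kindˣ (absorb i v j Γ refl) = refl
  kindˣ (insert i v Γ refl) rewrite isEven-even i = refl
  kindˣ (alone′ i v _) = refl
  kindˣ (raise′ i v g Γ refl) rewrite isEven-even i = refl
  kindˣ (absorb′ i v j Γ refl) = refl

  halves : ∀ (S : ℕ → Shape) i i′ {x} → x ≡ i * 2 → x ≡ i′ * 2 → S i ≡ S i′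
  halves S i i′ eq eq′ = cong S (*-cancelʳ-≡ i i′ 2 (trans (sym eq) eq′))

  injectiveˣ : ∀ x y → targetˣ x ≡ targetˣ y → sourceˣ x ≡ sourceˣ y
  injectiveˣ (split k i v Γ eq) (split .k i′ .v .Γ eq′) refl = halves (λ i → shape (2 + k) [] [] (i * 3) 0 Γ) i i′ eq eq′
  injectiveˣ (alone i v eq) (alone i′ .v eq′) refl = halves (λ i → shape 0 [] [] (i * 3) 0 []) i i′ (sym eq) (sym eq′)
  injectiveˣ (raise i v g Γ eq) (raise i′ .v .g .Γ eq′) refl = halves (λ i → shape 0 [] [] (i * 3) 0 (g ∷ Γ)) i i′ eq eq′
  injectiveˣ (absorb i v j Γ eq) (absorb i′ .v .j .Γ eq′) refl = halves (λ i → shape 0 [] [] (i * 3) 0 ((m₁ + j * m) ∷ Γ)) i i′ eq eq′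
  injectiveˣ (insert i v Γ eq) (insert i′ .v .Γ eq′) refl = halves (λ i → shape 1 [] [] (i * 3) 0 Γ) i i′ eq eq′
  injectiveˣ (alone′ i v eq) (alone′ i′ .v eq′) refl = halves (λ i → shape 1 [] [] (i * 3) 0 []) i i′ (sym eq) (sym eq′)
  injectiveˣ (raise′ i v g Γ eq) (raise′ i′ .v .g .Γ eq′) refl = halves (λ i → shape 1 [] [] (i * 3) 0 (g ∷ Γ)) i i′ eq eq′
  injectiveˣ (absorb′ i v j Γ eq) (absorb′ i′ .v .j .Γ eq′) refl = halves (λ i → shape 1 [] [] (i * 3) 0 ((m₁ + suc j * m) ∷ Γ)) i i′ eq eq′

  weightˣ : ∀ x → targetWeight (targetˣ x) ≡ sourceWeight (sourceˣ x)
  weightˣ (split k i _ Γ refl) = rearrange m k i (sum Γ)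
    where
    rearrange : ∀ m k i G → (suc (k + 0) + 1) * m + (1 * m + 1 + (i * 2 * 3 + G)) ≡ (suc (2 + k + 0) + 0) * m + 1 + (i * 3 * 2 + G)
    rearrange = solve-∀
  weightˣ (alone i v eq) = trans (rearrange₁ m v) (trans (cong (λ d → 1 * m + 1 + d * 3) (sym eq)) (rearrange₂ m i))
    where
    rearrange₁ : ∀ m v → 3 * m + (1 * m + 1 + (v * 3 + 0)) ≡ 1 * m + 1 + (m + v) * 3
    rearrange₁ = solve-∀
    rearrange₂ : ∀ m i → 1 * m + 1 + i * 2 * 3 ≡ 1 * m + 1 + (i * 3 * 2 + 0)
    rearrange₂ = solve-∀
  weightˣ (raise i _ g Γ refl) = rearrange m i g (sum Γ)
    where
    rearrange : ∀ m i g G → 1 * m + (i * 2 * 3 + (suc g + G)) ≡ 1 * m + 1 + (i * 3 * 2 + (g + G))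
    rearrange = solve-∀
  weightˣ (absorb i _ j Γ refl) = rearrange m₁ i j (sum Γ)
    where
    rearrange : ∀ m₁ i j G → (suc (j + 0) + 1) * suc m₁ + (i * 2 * 3 + G) ≡ 1 * suc m₁ + 1 + (i * 3 * 2 + (m₁ + j * suc m₁ + G))
    rearrange = solve-∀
  weightˣ (insert i _ Γ refl) = rearrange m₁ i (sum Γ)
    where
    rearrange : ∀ m₁ i G → 1 * suc m₁ + (2 + (i * 2 * 3 + (m₁ + G))) ≡ 2 * suc m₁ + 1 + (i * 3 * 2 + G)
    rearrange = solve-∀
  weightˣ (alone′ i v eq) = trans (rearrange₁ m v) (trans (cong (λ d → 2 * m + 1 + d * 3) (sym eq)) (rearrange₂ m i))
    where
    rearrange₁ : ∀ m v → 4 * m + (1 * m + 1 + (v * 3 + 0)) ≡ 2 * m + 1 + (m + v) * 3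
    rearrange₁ = solve-∀
    rearrange₂ : ∀ m i → 2 * m + 1 + i * 2 * 3 ≡ 2 * m + 1 + (i * 3 * 2 + 0)
    rearrange₂ = solve-∀
  weightˣ (raise′ i _ g Γ refl) = rearrange m i g (sum Γ)
    where
    rearrange : ∀ m i g G → 2 * m + (i * 2 * 3 + (suc g + G)) ≡ 2 * m + 1 + (i * 3 * 2 + (g + G))
    rearrange = solve-∀
  weightˣ (absorb′ i _ j Γ refl) = rearrange m₁ i j (sum Γ)
    where
    rearrange : ∀ m₁ i j G → (suc (j + 1) + 2) * suc m₁ + (i * 2 * 3 + G) ≡ 2 * suc m₁ + 1 + (i * 3 * 2 + (m₁ + suc j * suc m₁ + G))
    rearrange = solve-∀

  biasˣ : ∀ x → length (Shape.s (targetˣ x)) ≤ length (Shape.t (targetˣ x))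
  biasˣ (split k i v Γ _) = ≤-refl
  biasˣ (alone i v _) = s≤s z≤n
  biasˣ (raise i v g Γ _) = z≤n
  biasˣ (absorb i v j Γ _) = z≤n
  biasˣ (insert i v Γ _) = z≤n
  biasˣ (alone′ i v _) = s≤s z≤n
  biasˣ (raise′ i v g Γ _) = z≤n
  biasˣ (absorb′ i v j Γ _) = z≤n

  Admissible : ℕ → List ℕ → Set
  Admissible _ Γ = All Other Γ × Descending Γ

  toSource toTarget : Shape → Profile
  toSource (shape h t s u v Γ) = profile s (h ∷ t) u v Γ
  toTarget (shape h t s u v Γ) = profile (h ∷ t) s u v Γ

  small-other : ∀ {x} → 4 ≤ x → x < m → Other x
  small-other 4≤x x<m = small-neither (≤-trans (s≤s (s≤s z≤n)) 4≤x) x<m , 4≤x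

  -- Residue 0 of the successor would need residue m - 1, and residue 1 would need residue 0.
  suc-other : ∀ {g} → Other g → g % m ≢ m₁ → Other (suc g)
  suc-other {g} ((≢0 , _) , 4≤g) ≢m₁ = (suc≢0 , suc≢1) , m≤n⇒m≤1+n 4≤g
    where
    suc%m : suc g % m ≡ suc (g % m)
    suc%m = begin
      suc g % m                          ≡⟨ cong (λ x → suc x % m) (m≡m%n+[m/n]*n g m) ⟩
      (suc (g % m) + g / m * m) % m      ≡⟨ [m+kn]%n≡m%n (suc (g % m)) (g / m) m ⟩
      suc (g % m) % m                    ≡⟨ m<n⇒m%n≡m (s≤s (≤∧≢⇒< (≤-pred (m%n<n g m)) ≢m₁)) ⟩
      suc (g % m)                        ∎
      where open ≡-Reasoning
    suc≢0 : suc g % m ≢ 0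
    suc≢0 eq = contradiction (trans (sym suc%m) eq) λ ()
    suc≢1 : suc g % m ≢ 1
    suc≢1 eq = ≢0 (suc-injective (trans (sym suc%m) eq))

  -- Starting from 2 m + 1 the weight only gives 6 j ≥ 2 m + 2. For `m` = 4 this forces j ≥ 2, which
  -- is enough.
  m≤2j′ : ∀ j → m ≡ 4 → 4 * m + 3 ≤ 2 * m + 1 + (j * 3 * 2 + 0) → m ≤ j * 2
  m≤2j′ j eq big = subst (_≤ j * 2) (sym eq) (bound j (subst (λ m → 4 * m + 3 ≤ 2 * m + 1 + (j * 3 * 2 + 0)) eq big))
    where
    bound : ∀ j → 19 ≤ 9 + (j * 3 * 2 + 0) → 4 ≤ j * 2
    bound 0 le = contradiction le (from-no (19 ≤? 9))
    bound 1 le = contradiction le (from-no (19 ≤? 15))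
    bound (suc (suc j)) _ = s≤s (s≤s (s≤s (s≤s z≤n)))

  raise-descending : ∀ {g Γ} → Descending (g ∷ Γ) → Descending (suc g ∷ Γ)
  raise-descending (Γ≤g ∷ desc) = All.map m≤n⇒m≤1+n Γ≤g ∷ desc

  coverˣ : ∀ h j Γ → Admissible h Γ → 4 * m + 3 ≤ sourceWeight (shape h [] [] (j * 3) 0 Γ) →
    ∃ λ x → sourceˣ x ≡ shape h [] [] (j * 3) 0 Γ × Admissible (Shape.h (targetˣ x)) (Shape.Γ (targetˣ x))
  coverˣ (suc (suc k)) j Γ ok _ = split k j (j * 2) Γ refl , refl , ok
  coverˣ 0 j [] ok big = alone j (j * 2 ∸ m) (sym (m+[n∸m]≡n (m≤2j m j big))) , refl , ok
  coverˣ 0 j (g ∷ Γ) (g-other ∷ others , desc) big with g % m ≟ m₁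
  ... | yes g%m≡m₁ =
    absorb j (j * 2) (g / m) Γ refl ,
    cong (λ g → shape 0 [] [] (j * 3) 0 (g ∷ Γ)) (sym (trans (m≡m%n+[m/n]*n g m) (cong (_+ g / m * m) g%m≡m₁))) ,
    others , AllPairs.tail desc
  ... | no g%m≢m₁ = raise j (j * 2) g Γ refl , refl , suc-other g-other g%m≢m₁ ∷ others , raise-descending desc
  -- For `m` = 4 the part m - 1 would be a 3, which is counted by `v`; hence `alone′` replaces
  -- `insert`.
  coverˣ 1 j [] ok big with m₁ ≟ 3
  ... | yes m₁≡3 = alone′ j (j * 2 ∸ m) (sym (m+[n∸m]≡n (m≤2j′ j (cong suc m₁≡3) big))) , refl , ok
  ... | no m₁≢3 = insert j (j * 2) [] refl , refl , small-other (≤∧≢⇒< (≤-pred 4≤m) (m₁≢3 ∘ sym)) ≤-refl ∷ [] , [] ∷ []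
  coverˣ 1 j (g ∷ Γ) (g-other ∷ others , desc) big with g % m ≟ m₁
  ... | no g%m≢m₁ = raise′ j (j * 2) g Γ refl , refl , suc-other g-other g%m≢m₁ ∷ others , raise-descending desc
  ... | yes g%m≡m₁ = by-quotient (g / m) (trans (m≡m%n+[m/n]*n g m) (cong (_+ g / m * m) g%m≡m₁))
    where
    by-quotient : ∀ k → g ≡ m₁ + k * m →
      ∃ λ x → sourceˣ x ≡ shape 1 [] [] (j * 3) 0 (g ∷ Γ) × Admissible (Shape.h (targetˣ x)) (Shape.Γ (targetˣ x))
    -- The largest other part is m - 1 itself, so a second copy can be put in front without
    -- disturbing the order.
    by-quotient zero g≡ with refl ← trans g≡ (+-identityʳ m₁) =
      insert j (j * 2) (g ∷ Γ) refl , refl , g-other ∷ g-other ∷ others , (≤-refl ∷ AllPairs.head desc) ∷ desc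
    by-quotient (suc k) g≡ =
      absorb′ j (j * 2) k Γ refl , cong (λ g → shape 1 [] [] (j * 3) 0 (g ∷ Γ)) (sym g≡) , others , AllPairs.tail desc

  toTarget-injective : ∀ {S S′} → Admissible (Shape.h S) (Shape.Γ S) → Admissible (Shape.h S′) (Shape.Γ S′) → toTarget S ≡ toTarget S′ → S ≡ S′
  toTarget-injective {shape h t s u v Γ} {shape .h .t .s .u .v .Γ} _ _ refl = refl

  target-ok : ∀ S → Admissible (Shape.h S) (Shape.Γ S) → Valid (toTarget S) × weight (toTarget S) ≡ targetWeight S
  target-ok (shape h t s u v Γ) (others , desc) = (inj₁ (≤-trans (n≤1+n 3) 4≤m) , inj₁ 4≤m , others , desc) , refl

  decompose : ∀ P → Valid P → length (Profile.α P) < length (Profile.β P) →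
    ∃ λ S → toSource S ≡ P × Admissible (Shape.h S) (Shape.Γ S) × weight P ≡ sourceWeight S × length (Shape.s S) ≤ length (Shape.t S)
  decompose (profile s (h ∷ t) u v Γ) (_ , _ , others , desc) (s≤s bias) = shape h t s u v Γ , refl , (others , desc) , refl , bias

  theorem : ∀ n → 4 * m + 3 ≤ n → q 1 0 m n < q 0 1 m n
  theorem n big = witness (quotient-remainder m n big)
    where
    conclude : ∀ W → Admissible (Shape.h W) (Shape.Γ W) → kind W ≡ extra → targetWeight W ≡ n →
      length (Shape.s W) ≤ length (Shape.t W) → (∀ x → targetˣ x ≢ W) → q 1 0 m n < q 0 1 m n
    conclude = biased-<-by-extension n big Admissible toSource toTarget (λ {S} {S′} → toTarget-injective {S} {S′}) target-ok
      (λ { (shape _ _ _ _ _ _) → s≤s }) decompose X sourceˣ targetˣ kindˣ injectiveˣ weightˣ biasˣ coverˣ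

    ones-missed : ∀ {k u v Γ} x → targetˣ x ≢ shape k (0 ∷ 0 ∷ 0 ∷ []) [] u v Γ
    ones-missed (split _ _ _ _ _) ()
    ones-missed (alone _ _ _) ()
    ones-missed (raise _ _ _ _ _) ()
    ones-missed (absorb _ _ _ _ _) ()
    ones-missed (insert _ _ _ _) ()
    ones-missed (alone′ _ _ _) ()
    ones-missed (raise′ _ _ _ _ _) ()
    ones-missed (absorb′ _ _ _ _ _) ()

    two-missed : ∀ {k u v Γ} x → targetˣ x ≢ shape k (0 ∷ 0 ∷ []) [ 1 ] u v Γ
    two-missed (split _ _ _ _ _) ()
    two-missed (alone _ _ _) ()
    two-missed (raise _ _ _ _ _) ()
    two-missed (absorb _ _ _ _ _) ()
    two-missed (insert _ _ _ _) ()
    two-missed (alone′ _ _ _) ()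
    two-missed (raise′ _ _ _ _ _) ()
    two-missed (absorb′ _ _ _ _ _) ()

    2+m-other : Other (2 + 1 * m)
    2+m-other = subst (λ r → r ≢ 0 × r ≢ 1) (sym (trans ([m+kn]%n≡m%n 2 1 m) (m<n⇒m%n≡m (≤-trans (n≤1+n 3) 4≤m)))) ((λ ()) , λ ()) ,
      ≤-trans 4≤m (≤-trans (≤-reflexive (sym (*-identityˡ m))) (m≤n+m (1 * m) 2))

    witness : (∃₂ λ k r → n ≡ r + (4 + k) * m × r < m × (3 ≤ r ⊎ 1 ≤ k)) → q 1 0 m n < q 0 1 m n
    witness (k , 0 , n≡ , _) = conclude (shape k (0 ∷ 0 ∷ 0 ∷ []) [] 0 0 []) ([] , []) refl
      (trans (rearrange m k) (sym n≡)) z≤n ones-missed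
      where
      rearrange : ∀ m k → (suc (k + 0) + 3) * m + 0 ≡ (4 + k) * m
      rearrange = solve-∀
    -- The one is 2 m + 1, whereas `alone` and `alone′` have m + 1.
    witness (suc k , 1 , n≡ , _) = conclude (shape k (0 ∷ 0 ∷ []) [ 1 ] 0 0 []) ([] , []) refl
      (trans (rearrange m k) (sym n≡)) (s≤s z≤n) two-missed
      where
      rearrange : ∀ m k → (suc (k + 0) + 2) * m + (2 * m + 1 + 0) ≡ 1 + (5 + k) * m
      rearrange = solve-∀
    -- A part 2 would change the kind to `removed`, so the remainder is joined with the spare `m`
    -- into the part m + 2.
    witness (suc k , 2 , n≡ , _) = conclude (shape k (0 ∷ 0 ∷ 0 ∷ []) [] 0 0 [ 2 + 1 * m ]) (2+m-other ∷ [] , [] ∷ []) refl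
      (trans (rearrange m k) (sym n≡)) z≤n ones-missed
      where
      rearrange : ∀ m k → (suc (k + 0) + 3) * m + (2 + 1 * m + 0) ≡ 2 + (5 + k) * m
      rearrange = solve-∀
    witness (k , 3 , n≡ , _) = conclude (shape k (0 ∷ 0 ∷ 0 ∷ []) [] 0 1 []) ([] , []) refl
      (trans (rearrange m k) (sym n≡)) z≤n ones-missed
      where
      rearrange : ∀ m k → (suc (k + 0) + 3) * m + 3 ≡ 3 + (4 + k) * m
      rearrange = solve-∀
    witness (k , r@(suc (suc (suc (suc _)))) , n≡ , r<m , _) = conclude (shape k (0 ∷ 0 ∷ 0 ∷ []) [] 0 0 [ r ])
      (small-other (s≤s (s≤s (s≤s (s≤s z≤n)))) r<m ∷ [] , [] ∷ []) refl
      (trans (rearrange m k r) (sym n≡)) z≤n ones-missed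
      where
      rearrange : ∀ m k r → (suc (k + 0) + 3) * m + (r + 0) ≡ r + (4 + k) * m
      rearrange = solve-∀
    witness (0 , 1 , _ , _ , inj₁ (s≤s ()))
    witness (0 , 2 , _ , _ , inj₁ (s≤s (s≤s ())))

-- The three ranges of the modulus combined

theorem2p2 : (m : ℕ) → .{{_ : NonZero m}} → 2 ≤ m → (n : ℕ) → 4 * m + 3 ≤ n →
    q 1 0 m n < q 0 1 m n
theorem2p2 0 ()
theorem2p2 1 (s≤s ())
theorem2p2 2 _ = ModulusTwo.theorem
theorem2p2 3 _ = ModulusThree.theorem
theorem2p2 (suc (suc (suc (suc m)))) _ = ModulusLarge.theorem (suc (suc (suc m))) (s≤s (s≤s (s≤s (s≤s z≤n))))
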